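{- Let $a\ge2$ be an integer. The orbits of rowmotion on the fence $\breve F(a,1,a,1,a)$ can be partitioned into three sets $\mathcal S,\mathcal M,\mathcal L$, called small, medium, and large, having the following properties. (a) We have $$\#\mathcal S=2a-2,\quad \#\mathcal M=1,\quad \#\mathcal L=a,$$ and $$\#\mathcal O=\begin{cases}a+1&\text{if }\mathcal O\in\mathcal S,\\ 3a+2&\text{if }\mathcal O\in\mathcal M,\\ a^2+2a&\text{if }\mathcal O\in\mathcal L.\end{cases}$$ (b) For rowmotion on antichains, $\chi$ is homometric with $$\chi(\mathcal O)=\begin{cases}3a&\text{if }\mathcal O\in\mathcal S,\\ 9a-3&\text{if }\mathcal O\in\mathcal M,\\ 3a^2+3a-2&\text{if }\mathcal O\in\mathcal L.\end{cases}$$ (c) The dihedral group orbits are pairs of orbits in $\mathcal S$ (that is, unions of two distinct orbits in $\mathcal S$) and single orbits in $\mathcal M$ and $\mathcal L$.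
   Context: The fence $\breve F(a,1,a,1,a)$ is the poset on $x_1,\dots,x_n$, $n=3a+1$, with covering relations $x_1\lhd\cdots\lhd x_a\rhd x_{a+1}\lhd x_{a+2}\lhd\cdots\lhd x_{2a+1}\rhd x_{2a+2}\lhd x_{2a+3}\lhd\cdots\lhd x_{3a+1}$. For a finite poset $P$, rowmotion on antichains is the bijection $\rho$ on the set of antichains sending $A$ to the set of minimal elements of $P\setminus I$, where $I$ is the (lower order) ideal generated by $A$. Rowmotion on ideals is the bijection $\hat\rho$ on the set $\mathcal I(P)$ of ideals sending $I$ to the ideal generated by the minimal elements of $P\setminus I$. Orbits are those of the cyclic groups generated by these maps; $A\mapsto$ (ideal generated by $A$) gives a size-preserving bijection between orbits of $\rho$ and of $\hat\rho$, and corresponding orbits are identified. For an orbit $\mathcal O$, $\#\mathcal O$ is the number of antichains (equivalently, ideals) in it, and $\chi(\mathcal O)=\sum_A\#A$ over the antichains $A$ in the orbit. The statistic $\chi$ is homometric if $\#\mathcal O_1=\#\mathcal O_2$ implies $\chi(\mathcal O_1)=\chi(\mathcal O_2)$ for all orbits $\mathcal O_1,\mathcal O_2$. The fence is self-dual via the order-reversing bijection $\kappa(x_k)=x_{n+1-k}$. The ideal complement of an ideal $I$ is $\overline I=\kappa(P\setminus I)$, where $P=\breve F(a,1,a,1,a)$. The dihedral group orbits are the orbits on $\mathcal I(P)$ of the group generated by $\hat\rho$ and $I\mapsto\overline I$.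
   Formalization: Homometry in (b) is claimed only for a ≥ 3: for a = 2 the medium and large orbits both have size 8, but χ is 15 and 16 respectively, so the claim as printed fails there; all other assertions are kept for a ≥ 2. -}

module Defs where

import Data.Bool.Properties as Bool
open import Data.Empty using (⊥-elim)
open import Data.Empty.Irrelevant using () renaming (⊥-elim to ⊥-elim-irr)
open import Data.Fin.Base using (Fin; toℕ; opposite)
import Data.Fin.Properties as Fin
open import Data.Fin.Subset using (Subset; inside; outside; _∈_; _∉_; ∁; ∣_∣)
open import Data.Fin.Subset.Properties using (_∈?_; x∈∁p⇒x∉p; x∉p⇒x∈∁p)
open import Data.Irrelevant using ([_])
open import Data.List.Base as List using (List; []; _∷_; _++_; length; filter; sum; allFin)
import Data.List.Membership.Propositional as List
open import Data.List.Membership.Propositional.Properties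
  using (∈-++⁺ˡ; ∈-++⁺ʳ; ∈-map⁺; ∈-allFin)
open import Data.List.Relation.Unary.Any using (here; there)
open import Data.Nat.Base using (ℕ; zero; suc; _+_; _*_; _≤_; _<_; z≤n; s≤s)
import Data.Nat.Properties as ℕ
open import Data.Nat.Tactic.RingSolver using (solve-∀)
open import Data.Product.Base using (Σ; ∃; _×_; _,_; proj₁; proj₂)
open import Data.Refinement using (Refinement; Refinement-syntax; value; _,_)
import Data.Refinement.Properties as Refinement
open import Data.Sum.Base using (_⊎_; inj₁; inj₂)
open import Data.Vec.Base using ([]; _∷_; tabulate; lookup)
import Data.Vec.Properties as Vec
open import Function.Base using (_∘_)
open import Function.Bundles using (_⇔_; Bijection)
open import Level using (0ℓ)
open import Relation.Binary.Bundles using (Setoid)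
open import Relation.Binary.Core using (Rel)
open import Relation.Binary.Definitions using (Decidable; DecidableEquality)
open import Relation.Binary.PropositionalEquality as ≡
  using (_≡_; _≢_; refl; sym; trans; cong; cong₂; subst)
open import Relation.Binary.Structures using (IsDecPartialOrder)
import Relation.Binary.Construct.Closure.Equivalence as Eq
open import Relation.Binary.Construct.Closure.Equivalence using (EqClosure)
open import Relation.Binary.Construct.Closure.ReflexiveTransitive
  using (Star; ε; _◅_; _◅◅_)
open import Relation.Binary.Construct.Closure.Symmetric using (SymClosure; fwd; bwd)
import Relation.Binary.Construct.On as On
open import Relation.Nullary.Decidable
  using (Dec; yes; no; does; map′; dec-true; ¬?; _×-dec_; _⊎-dec_; _→-dec_)
open import Relation.Nullary.Negation using (¬_)
import Relation.Unary as Unary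

------------------------------------------------------------------------
-- Closures of decidable relations on finite types are decidable

module FiniteClosure {X : Set} (_≟_ : DecidableEquality X)
                     (xs : List X) (complete : ∀ x → x List.∈ xs) where

  -- Paths all of whose interior vertices lie in the given list
  -- (Floyd–Warshall).
  Via : Rel X 0ℓ → List X → Rel X 0ℓ
  Via R []       x y = R x y
  Via R (v ∷ vs) x y = Via R vs x y ⊎ (Via R vs x v × Via R vs v y)

  via? : ∀ {R} → Decidable R → ∀ vs → Decidable (Via R vs)
  via? R? []       x y = R? x y
  via? R? (v ∷ vs) x y = via? R? vs x y ⊎-dec (via? R? vs x v ×-dec via? R? vs v y)

  module _ {R : Rel X 0ℓ} where

    via⇒star : ∀ vs {x y} → Via R vs x y → Star R x y
    via⇒star []       r              = r ◅ ε
    via⇒star (v ∷ vs) (inj₁ p)       = via⇒star vs p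
    via⇒star (v ∷ vs) (inj₂ (p , q)) = via⇒star vs p ◅◅ via⇒star vs q

    R⇒via : ∀ vs {x y} → R x y → Via R vs x y
    R⇒via []       r = r
    R⇒via (v ∷ vs) r = inj₁ (R⇒via vs r)

    via-trans : ∀ vs {x y z} → y List.∈ vs → Via R vs x y → Via R vs y z → Via R vs x z
    via-trans (v ∷ vs) (here refl) p q = inj₂ (into p , outof q)
      where
      into : ∀ {x} → Via R (v ∷ vs) x v → Via R vs x v
      into (inj₁ r)       = r
      into (inj₂ (r , _)) = r
      outof : ∀ {z} → Via R (v ∷ vs) v z → Via R vs v z
      outof (inj₁ r)       = r
      outof (inj₂ (_ , r)) = r
    via-trans (v ∷ vs) (there y∈) (inj₁ p)       (inj₁ q)       = inj₁ (via-trans vs y∈ p q)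
    via-trans (v ∷ vs) (there y∈) (inj₁ p)       (inj₂ (q , r)) = inj₂ (via-trans vs y∈ p q , r)
    via-trans (v ∷ vs) (there y∈) (inj₂ (p , q)) (inj₁ r)       = inj₂ (p , via-trans vs y∈ q r)
    via-trans (v ∷ vs) (there y∈) (inj₂ (p , _)) (inj₂ (_ , s)) = inj₂ (p , s)

    star⇒via : ∀ {x y} → Star R x y → x ≡ y ⊎ Via R xs x y
    star⇒via ε = inj₁ refl
    star⇒via (r ◅ rs) with star⇒via rs
    ... | inj₁ refl = inj₂ (R⇒via xs r)
    ... | inj₂ p    = inj₂ (via-trans xs (complete _) (R⇒via xs r) p)

    star? : Decidable R → Decidable (Star R)
    star? R? x y = map′ from star⇒via ((x ≟ y) ⊎-dec via? R? xs x y)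
      where
      from : x ≡ y ⊎ Via R xs x y → Star R x y
      from (inj₁ refl) = ε
      from (inj₂ p)    = via⇒star xs p

  eqClosure? : ∀ {R} → Decidable R → Decidable (EqClosure R)
  eqClosure? {R} R? = star? symClosure?
    where
    symClosure? : Decidable (SymClosure R)
    symClosure? x y = map′ (λ { (inj₁ r) → fwd r ; (inj₂ r) → bwd r })
                           (λ { (fwd r) → inj₁ r ; (bwd r) → inj₂ r })
                           (R? x y ⊎-dec R? y x)

------------------------------------------------------------------------
-- Finite subsets

⟦_⟧ : ∀ {n} {P : Unary.Pred (Fin n) 0ℓ} → Unary.Decidable P → Subset n
⟦ P? ⟧ = tabulate (does ∘ P?)

module _ {n} {P : Unary.Pred (Fin n) 0ℓ} (P? : Unary.Decidable P) where

  ∈⟦⟧⁺ : ∀ {x} → P x → x ∈ ⟦ P? ⟧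
  ∈⟦⟧⁺ {x} px = Vec.lookup⇒[]= x _ (trans (Vec.lookup∘tabulate (does ∘ P?) x) (dec-true (P? x) px))

  ∈⟦⟧⁻ : ∀ {x} → x ∈ ⟦ P? ⟧ → P x
  ∈⟦⟧⁻ {x} x∈ with P? x | trans (sym (Vec.lookup∘tabulate (does ∘ P?) x)) (Vec.[]=⇒lookup x∈)
  ... | yes px | _  = px
  ... | no _   | ()

subsets : ∀ n → List (Subset n)
subsets zero    = [] ∷ []
subsets (suc n) = List.map (outside ∷_) (subsets n) ++ List.map (inside ∷_) (subsets n)

∈-subsets : ∀ {n} (p : Subset n) → p List.∈ subsets n
∈-subsets []            = here refl
∈-subsets (outside ∷ p) = ∈-++⁺ˡ (∈-map⁺ (outside ∷_) (∈-subsets p))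
∈-subsets (inside ∷ p)  = ∈-++⁺ʳ (List.map (outside ∷_) (subsets _)) (∈-map⁺ (inside ∷_) (∈-subsets p))

module _ {A : Set} {P : Unary.Pred A 0ℓ} (P? : Unary.Decidable P) where

  refinements : List A → List [ x ∈ A ∣ P x ]
  refinements [] = []
  refinements (x ∷ xs) with P? x
  ... | yes px = (x , [ px ]) ∷ refinements xs
  ... | no _   = refinements xs

  ∈-refinements : ∀ {xs} (r : [ x ∈ A ∣ P x ]) → value r List.∈ xs → r List.∈ refinements xs
  ∈-refinements {x ∷ xs} r (there r∈) with P? x
  ... | yes _ = there (∈-refinements r r∈)
  ... | no _  = ∈-refinements r r∈
  ∈-refinements {x ∷ xs} (_ , [ p ]) (here refl) with P? x
  ... | yes _ = here refl
  ... | no ¬p = ⊥-elim-irr (¬p p)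

------------------------------------------------------------------------
-- Rowmotion on a finite poset

module Rowmotion {n : ℕ} {_⊑_ : Rel (Fin n) 0ℓ}
                 (isDecPartialOrder : IsDecPartialOrder _≡_ _⊑_) where

  private
    module ⊑ = IsDecPartialOrder isDecPartialOrder
    _⊑?_ : Decidable _⊑_
    _⊑?_ = ⊑._≤?_

  IsAntichain : Subset n → Set
  IsAntichain A = ∀ x y → x ∈ A → y ∈ A → x ⊑ y → x ≡ y

  IsIdeal : Subset n → Set
  IsIdeal I = ∀ x y → y ∈ I → x ⊑ y → x ∈ I

  -- The proof component is irrelevant, so equality is equality of subsets.
  Antichain : Set
  Antichain = [ A ∈ Subset n ∣ IsAntichain A ]

  Ideal : Set
  Ideal = [ I ∈ Subset n ∣ IsIdeal I ]

  IsMinimalIn : Subset n → Fin n → Set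
  IsMinimalIn S x = x ∈ S × (∀ y → y ∈ S → y ⊑ x → y ≡ x)

  isMinimalIn? : ∀ S → Unary.Decidable (IsMinimalIn S)
  isMinimalIn? S x = (x ∈? S) ×-dec
    Fin.all? (λ y → (y ∈? S) →-dec ((y ⊑? x) →-dec (y Fin.≟ x)))

  minimals : Subset n → Antichain
  minimals S = ⟦ isMinimalIn? S ⟧ , [ antichain ]
    where
    antichain : IsAntichain ⟦ isMinimalIn? S ⟧
    antichain x y x∈ y∈ x⊑y =
      proj₂ (∈⟦⟧⁻ (isMinimalIn? S) y∈) x (proj₁ (∈⟦⟧⁻ (isMinimalIn? S) x∈)) x⊑y

  IsBelow : Subset n → Fin n → Set
  IsBelow S x = ∃ λ y → y ∈ S × x ⊑ y

  isBelow? : ∀ S → Unary.Decidable (IsBelow S)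
  isBelow? S x = Fin.any? (λ y → (y ∈? S) ×-dec (x ⊑? y))

  generated : Subset n → Ideal
  generated S = ⟦ isBelow? S ⟧ , [ ideal ]
    where
    ideal : IsIdeal ⟦ isBelow? S ⟧
    ideal x y y∈ x⊑y with ∈⟦⟧⁻ (isBelow? S) y∈
    ... | z , z∈S , y⊑z = ∈⟦⟧⁺ (isBelow? S) (z , z∈S , ⊑.trans x⊑y y⊑z)

  ⟨_⟩ : Antichain → Ideal
  ⟨ A ⟩ = generated (value A)

  ρ : Antichain → Antichain
  ρ A = minimals (∁ (value ⟨ A ⟩))

  ρ̂ : Ideal → Ideal
  ρ̂ I = ⟨ minimals (∁ (value I)) ⟩

  -- Lying in the same orbit of the group generated by a set of bijections
  -- is the equivalence relation generated by the graphs of those bijections.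
  infix 4 _∼_ _∼̂_
  _∼_ : Rel Antichain 0ℓ
  _∼_ = EqClosure (λ A B → ρ A ≡ B)

  _∼̂_ : Rel Ideal 0ℓ
  _∼̂_ = EqClosure (λ I J → ρ̂ I ≡ J)

  -- The set of orbits, as a quotient: antichains up to lying in the same orbit.
  orbits : Setoid 0ℓ 0ℓ
  orbits = Eq.setoid (λ A B → ρ A ≡ B)

  isAntichain? : Unary.Decidable IsAntichain
  isAntichain? A = Fin.all? λ x → Fin.all? λ y →
    (x ∈? A) →-dec ((y ∈? A) →-dec ((x ⊑? y) →-dec (x Fin.≟ y)))

  antichains : List Antichain
  antichains = refinements isAntichain? (subsets n)

  _≟ᴬ_ : DecidableEquality Antichain
  _≟ᴬ_ = Refinement._≟_ (Vec.≡-dec Bool._≟_)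

  _∼?_ : Decidable _∼_
  _∼?_ = eqClosure? (λ A B → ρ A ≟ᴬ B)
    where
    open FiniteClosure _≟ᴬ_ antichains
      (λ A → ∈-refinements isAntichain? A (∈-subsets (value A)))

  orbit : Antichain → List Antichain
  orbit A = filter (A ∼?_) antichains

  #_ : Antichain → ℕ
  # A = length (orbit A)

  χ : Antichain → ℕ
  χ A = sum (List.map (λ B → ∣ value B ∣) (orbit A))

  Homometric : Set
  Homometric = ∀ A B → # A ≡ # B → χ A ≡ χ B

------------------------------------------------------------------------
-- The fence F̆(a,1,a,1,a)

module Fence (a : ℕ) where

  n : ℕ
  n = 3 * a + 1

  -- The element x of Fin n is the point x_k with k = index x.
  index : Fin n → ℕ
  index x = suc (toℕ x)

  Peak : ℕ → Set
  Peak k = k ≡ a ⊎ k ≡ 2 * a + 1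

  infix 4 _⋖_ _⊑_
  _⋖_ : Rel (Fin n) 0ℓ
  x ⋖ y = (index y ≡ suc (index x) × ¬ Peak (index x))
        ⊎ (index x ≡ suc (index y) × Peak (index y))

  _⊑_ : Rel (Fin n) 0ℓ
  _⊑_ = Star _⋖_

  peak? : Unary.Decidable Peak
  peak? k = (k ℕ.≟ a) ⊎-dec (k ℕ.≟ 2 * a + 1)

  _⋖?_ : Decidable _⋖_
  x ⋖? y = ((index y ℕ.≟ suc (index x)) ×-dec ¬? (peak? (index x)))
     ⊎-dec ((index x ℕ.≟ suc (index y)) ×-dec peak? (index y))

  private
    bonus : ℕ → ℕ → ℕ
    bonus b k with k ℕ.≤? b
    ... | yes _ = 2
    ... | no _  = 0

    bonus-anti : ∀ b k → bonus b (suc k) ≤ bonus b k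
    bonus-anti b k with suc k ℕ.≤? b | k ℕ.≤? b
    ... | yes _ | yes _ = ℕ.≤-refl
    ... | yes p | no ¬p = ⊥-elim (¬p (ℕ.<⇒≤ p))
    ... | no _  | _     = z≤n

    bonus-suc : ∀ b k → k ≢ b → bonus b (suc k) ≡ bonus b k
    bonus-suc b k k≢b with suc k ℕ.≤? b | k ℕ.≤? b
    ... | yes _ | yes _ = refl
    ... | yes p | no ¬p = ⊥-elim (¬p (ℕ.<⇒≤ p))
    ... | no ¬p | yes p = ⊥-elim (¬p (ℕ.≤∧≢⇒< p k≢b))
    ... | no _  | no _  = refl

    bonus-at : ∀ b → bonus b b ≡ 2 + bonus b (suc b)
    bonus-at b with b ℕ.≤? b | suc b ℕ.≤? b
    ... | yes _ | no _  = refl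
    ... | _     | yes p = ⊥-elim (ℕ.1+n≰n p)
    ... | no ¬p | _     = ⊥-elim (¬p ℕ.≤-refl)

    -- Strictly increasing along covers, whence antisymmetry.
    height : ℕ → ℕ
    height k = k + (bonus a k + bonus (2 * a + 1) k)

    height-up : ∀ k → ¬ Peak k → height k < height (suc k)
    height-up k ¬peak = s≤s (ℕ.≤-reflexive (cong (k +_) (sym (cong₂ _+_
      (bonus-suc a k (¬peak ∘ inj₁)) (bonus-suc (2 * a + 1) k (¬peak ∘ inj₂))))))

    bound : ∀ k {b c} → 2 + b ≤ c → suc k + b < k + c
    bound k {b} h = ℕ.≤-trans (ℕ.≤-reflexive (lemma k b)) (ℕ.+-monoʳ-≤ k h)
      where
      lemma : ∀ k b → 2 + (k + b) ≡ k + (2 + b)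
      lemma = solve-∀

    height-down : ∀ k → Peak k → height (suc k) < height k
    height-down k (inj₁ refl) = bound k
      (ℕ.+-mono-≤ (ℕ.≤-reflexive (sym (bonus-at k))) (bonus-anti (2 * a + 1) k))
    height-down k (inj₂ refl) = bound k (ℕ.≤-trans
      (ℕ.≤-reflexive (lemma (bonus a (suc k)) (bonus k (suc k))))
      (ℕ.+-mono-≤ (bonus-anti a k) (ℕ.≤-reflexive (sym (bonus-at k)))))
      where
      lemma : ∀ p q → 2 + (p + q) ≡ p + (2 + q)
      lemma = solve-∀

    ⋖⇒< : ∀ {x y} → x ⋖ y → height (index x) < height (index y)
    ⋖⇒< {x} {y} (inj₁ (eq , ¬peak)) =
      subst (λ k → height (index x) < height k) (sym eq) (height-up (index x) ¬peak)
    ⋖⇒< {x} {y} (inj₂ (eq , peak)) =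
      subst (λ k → height k < height (index y)) (sym eq) (height-down (index y) peak)

    ⊑⇒≤ : ∀ {x y} → x ⊑ y → height (index x) ≤ height (index y)
    ⊑⇒≤ ε        = ℕ.≤-refl
    ⊑⇒≤ (c ◅ cs) = ℕ.≤-trans (ℕ.<⇒≤ (⋖⇒< c)) (⊑⇒≤ cs)

    ⊑-antisym : ∀ {x y} → x ⊑ y → y ⊑ x → x ≡ y
    ⊑-antisym ε        _ = refl
    ⊑-antisym (c ◅ cs) d = ⊥-elim (ℕ.<⇒≱ (⋖⇒< c) (⊑⇒≤ (cs ◅◅ d)))

  isDecPartialOrder : IsDecPartialOrder _≡_ _⊑_
  isDecPartialOrder = record
    { isPartialOrder = record
      { isPreorder = record
        { isEquivalence = ≡.isEquivalence
        ; reflexive     = λ { refl → ε }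
        ; trans         = _◅◅_
        }
      ; antisym = ⊑-antisym
      }
    ; _≟_  = Fin._≟_
    ; _≤?_ = FiniteClosure.star? Fin._≟_ (allFin n) ∈-allFin _⋖?_
    }

  open Rowmotion isDecPartialOrder public

  κ : Fin n → Fin n
  κ = opposite

  private
    index-κ : ∀ x → index x + index (κ x) ≡ 3 * a + 2
    index-κ x = trans (cong (λ k → index x + suc k) (Fin.opposite-prop x))
      (trans (ℕ.+-suc (index x) _)
      (trans (cong suc (ℕ.m+[n∸m]≡n (Fin.toℕ<n x))) (sym (ℕ.+-suc (3 * a) 1))))

    shift : ∀ x y → index y ≡ suc (index x) → index (κ x) ≡ suc (index (κ y))
    shift x y eq = ℕ.+-cancelˡ-≡ (index x) _ _ (trans (index-κ x)
      (trans (sym (index-κ y)) (trans (cong (_+ index (κ y)) eq) (sym (ℕ.+-suc (index x) _)))))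

    peak-sym : ∀ k l → k + l ≡ 3 * a + 1 → Peak k → Peak l
    peak-sym k l eq (inj₁ refl) = inj₂ (ℕ.+-cancelˡ-≡ a _ _ (trans eq (lemma a)))
      where
      lemma : ∀ a → 3 * a + 1 ≡ a + (2 * a + 1)
      lemma = solve-∀
    peak-sym k l eq (inj₂ refl) = inj₁ (ℕ.+-cancelˡ-≡ (2 * a + 1) _ _ (trans eq (lemma a)))
      where
      lemma : ∀ a → 3 * a + 1 ≡ 2 * a + 1 + a
      lemma = solve-∀

    sum-κ : ∀ x y → index y ≡ suc (index x) → index x + index (κ y) ≡ 3 * a + 1
    sum-κ x y eq = ℕ.suc-injective
      (trans (cong (_+ index (κ y)) (sym eq)) (trans (index-κ y) (ℕ.+-suc (3 * a) 1)))

    κ-⋖ : ∀ {x y} → x ⋖ y → κ y ⋖ κ x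
    κ-⋖ {x} {y} (inj₁ (eq , ¬peak)) = inj₁ (shift x y eq ,
      λ peak → ¬peak (peak-sym (index (κ y)) (index x)
        (trans (ℕ.+-comm (index (κ y)) (index x)) (sum-κ x y eq)) peak))
    κ-⋖ {x} {y} (inj₂ (eq , peak)) = inj₂ (shift y x eq ,
      peak-sym (index y) (index (κ x)) (sum-κ y x eq) peak)

    κ-⊑ : ∀ {x y} → x ⊑ y → κ y ⊑ κ x
    κ-⊑ ε        = ε
    κ-⊑ (c ◅ cs) = κ-⊑ cs ◅◅ (κ-⋖ c ◅ ε)

  IsImageOutside : Subset n → Fin n → Set
  IsImageOutside S y = ∃ λ x → x ∉ S × κ x ≡ y

  isImageOutside? : ∀ S → Unary.Decidable (IsImageOutside S)
  isImageOutside? S y = Fin.any? (λ x → ¬? (x ∈? S) ×-dec (κ x Fin.≟ y))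

  complement : Ideal → Ideal
  complement (I , [ isIdeal ]) = ⟦ isImageOutside? I ⟧ , [ ideal isIdeal ]
    where
    ideal : IsIdeal I → IsIdeal ⟦ isImageOutside? I ⟧
    ideal isIdeal z y y∈ z⊑y with ∈⟦⟧⁻ (isImageOutside? I) y∈
    ... | x , x∉I , refl = ∈⟦⟧⁺ (isImageOutside? I)
      (κ z , x∉I ∘ (λ κz∈I → isIdeal x (κ z) κz∈I x⊑κz) , Fin.opposite-involutive z)
      where
      x⊑κz : x ⊑ κ z
      x⊑κz = subst (_⊑ κ z) (Fin.opposite-involutive x) (κ-⊑ z⊑y)

  infix 4 _∼ᴰ_
  _∼ᴰ_ : Rel Ideal 0ℓ
  _∼ᴰ_ = EqClosure (λ I J → ρ̂ I ≡ J ⊎ complement I ≡ J)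

  -- The orbit of ρ̂ corresponding to the orbit of A is the ∼̂-class of ⟨ A ⟩.
  DihedralOrbitIs : Ideal → Antichain → Set
  DihedralOrbitIs I A = ∀ J → I ∼ᴰ J ⇔ ⟨ A ⟩ ∼̂ J

  DihedralOrbitIsUnion : Ideal → Antichain → Antichain → Set
  DihedralOrbitIsUnion I A B = ∀ J → I ∼ᴰ J ⇔ (⟨ A ⟩ ∼̂ J ⊎ ⟨ B ⟩ ∼̂ J)

data Class : Set where
  small medium large : Class

-- A partition of the set of orbits into three sets, as a function from orbits
-- to classes; its parts may be empty.
record Partition (a : ℕ) : Set where
  open Fence a
  field
    class    : Antichain → Class
    respects : ∀ {A B} → A ∼ B → class A ≡ class B

  part : Class → Setoid 0ℓ 0ℓ
  part c = On.setoid {B = Σ Antichain (λ A → class A ≡ c)} orbits proj₁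

infix 4 _hasCardinality_
_hasCardinality_ : Setoid 0ℓ 0ℓ → ℕ → Set
S hasCardinality k = Bijection (≡.setoid (Fin k)) S

{-# OPTIONS --safe #-}
module Submission where

open import Defs
open import Data.Empty.Irrelevant using () renaming (⊥-elim to ⊥-elim-irr)
open import Data.Fin.Base using (Fin; zero; suc; toℕ; fromℕ<)
import Data.Fin.Properties as Fin
open import Data.Fin.Subset using (Subset; inside; outside; _∈_; _∉_; ∣_∣; ∁)
open import Data.Fin.Subset.Properties using (_∈?_; ⊆-antisym; x∈∁p⇒x∉p; x∉p⇒x∈∁p)
open import Data.Irrelevant using ([_])
open import Data.List.Base as List using (List; []; _∷_; _++_; length; filter; iterate)
import Data.List.Membership.Propositional as List
open import Data.List.Membership.Propositional.Properties
  using (∈-map⁺; ∈-map⁻; ∈-filter⁺; ∈-filter⁻; ∈-++⁺ˡ; ∈-++⁺ʳ; ∈-++⁻)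
open import Data.List.Membership.Propositional.Properties.WithK using (unique∧set⇒bag)
open import Data.List.Properties using (length-iterate; length-map; length-++)
open import Data.List.Relation.Binary.BagAndSetEquality using (∼bag⇒↭)
open import Data.List.Relation.Binary.Permutation.Propositional using (_↭_)
import Data.List.Relation.Binary.Permutation.Propositional.Properties as ↭
open import Data.List.Relation.Unary.All as All using (All; []; _∷_)
open import Data.List.Relation.Unary.AllPairs using ([]; _∷_)
open import Data.List.Relation.Unary.Any using (here; there)
open import Data.List.Relation.Unary.Unique.Propositional using (Unique)
import Data.List.Relation.Unary.Unique.Propositional.Properties as Unique
open import Data.Nat.Base using (ℕ; zero; suc; _+_; _*_; _∸_; _^_; _≤_; _<_; z≤n; s≤s)
open import Data.Nat.GeneralisedArithmetic using (fold)
open import Data.Nat.ListAction using (sum)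
open import Data.Nat.ListAction.Properties using (sum-↭)
import Data.Nat.Properties as ℕ
open import Data.Nat.Tactic.RingSolver using (solve-∀)
open import Data.Product.Base using (Σ; ∃; ∃₂; _×_; _,_; proj₁; proj₂)
open import Data.Refinement using (value; _,_)
import Data.Refinement.Properties as Refinement
open import Data.Sum.Base using (_⊎_; inj₁; inj₂)
open import Data.Unit.Base using (⊤; tt)
open import Data.Vec.Base using ([]; _∷_; here; there)
import Data.Vec.Properties as Vec
open import Function.Base using (_∘_)
open import Function.Bundles using (_⇔_; mk⇔; Equivalence; _↔_; Inverse)
import Function.Construct.Identity as Identity
open import Level using (0ℓ)
open import Relation.Binary.Bundles using (Setoid)
import Relation.Binary.Construct.Closure.Equivalence as Eq
open import Relation.Binary.Construct.Closure.Equivalence using (EqClosure)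
open import Relation.Binary.Construct.Closure.ReflexiveTransitive using (Star; ε; _◅_; _◅◅_)
open import Relation.Binary.Construct.Closure.Symmetric using (fwd; bwd)
import Relation.Binary.Construct.On as On
open import Relation.Binary.Core using (Rel)
open import Relation.Binary.PropositionalEquality
  using (_≡_; _≢_; refl; sym; trans; cong; cong₂; subst; subst₂)
open import Relation.Binary.Structures using (IsDecPartialOrder)
open import Relation.Nullary.Decidable using (Dec; yes; no)
open import Relation.Nullary.Negation using (¬_; contradiction)
import Relation.Unary as Unary

-- An ideal of the fence is a triple (i, j, k) counting its elements on the three maximal chains,
-- which have a, a + 1 and a elements.  Rowmotion advances each coordinate cyclically (it rises by one,
-- and falls from its maximum to 0), up to corrections where x_a covers x_{a+1} and x_{2a+1} covers
-- x_{2a+2}: there a rise can be blocked, or a coordinate can be pushed to 1 instead of falling to 0.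
-- Every orbit meets exactly once the set formed by (c, 0, 1) with c < a − 1 and (a − 1, a + 1, k)
-- with k ≥ 2 (small orbits), (a − 1, 0, 1) (the medium orbit) and (a − 1, 0, k) with k ≠ 1 (large
-- orbits).  Following such a point until it returns gives the size of its orbit, and χ as the number
-- of rises on the way.  In a large orbit, while j goes from 0 to a + 1 and back in a + 2 steps, both i
-- and the position of k among the a values other than 1 advance by one modulo a, so that a such loops
-- close up.  The ideal complement (i, j, k) ↦ (a − k, a + 1 − j, a − i) conjugates rowmotion to its
-- inverse and thus permutes the orbits; it exchanges (c, 0, 1) and (a − 1, a + 1, a − c), and fixes
-- the medium and the large orbits.

-- Rowmotion maps I to the ideal generated by the minimal points outside I, and on a maximal chain
-- only the lowest missing point can be minimal. So each coordinate rises by one or is reset, to 1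
-- if a generator on the preceding chain covers its bottom point and to 0 otherwise. The new i
-- depends on the old j, the new j on the old k and the new i, the new k on the new j; a step is
-- computed in this order. While the second chain climbs from 1 to a, the outer chains are
-- independent counters modulo a + 1. Only the moments when the second chain is empty, full or
-- blocked need separate study, and so the section lies where it is empty or full. That no orbit
-- avoids the section is not derived by counting ideals: every state is followed forward until it
-- enters. At a = 2 the medium and the large orbits all have 8 elements, with χ equal to 15 and 16
-- respectively, so equal sizes force equal χ only from a = 3 on.

↭-from-set : ∀ {A : Set} {xs ys : List A} → Unique xs → Unique ys →
             (∀ {x} → x List.∈ xs ⇔ x List.∈ ys) → xs ↭ ys
↭-from-set xs! ys! xs∼ys = ∼bag⇒↭ (unique∧set⇒bag xs! ys! xs∼ys)

-- Orbits are defined by filtering the list of all antichains. This replaces such a filter by an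
-- explicit duplicate-free enumeration without evaluating the decision procedure.
filter-↭ : ∀ {A : Set} {P : Unary.Pred A 0ℓ} (P? : Unary.Decidable P) {xs ys : List A} →
           Unique xs → (∀ x → x List.∈ xs) → Unique ys → (∀ {x} → P x ⇔ x List.∈ ys) →
           filter P? xs ↭ ys
filter-↭ P? {xs} xs! complete ys! P∼ys = ↭-from-set (Unique.filter⁺ P? xs!) ys! (mk⇔
  (λ x∈ → Equivalence.to P∼ys (proj₂ (∈-filter⁻ P? {xs = xs} x∈)))
  (λ x∈ → ∈-filter⁺ P? (complete _) (Equivalence.from P∼ys x∈)))

-- Duplicate-free enumerations of subsets and of their refinements.

subsets-unique : ∀ n → Unique (subsets n)
subsets-unique zero    = [] ∷ []
subsets-unique (suc n) = Unique.++⁺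
  (Unique.map⁺ Vec.∷-injectiveʳ (subsets-unique n))
  (Unique.map⁺ Vec.∷-injectiveʳ (subsets-unique n))
  λ { (p , q) → disjoint (∈-map⁻ (outside ∷_) p) (∈-map⁻ (inside ∷_) q) }
  where
  disjoint : ∀ {v : Subset (suc n)} → (∃ λ p → p List.∈ subsets n × v ≡ outside ∷ p) →
             ¬ (∃ λ p → p List.∈ subsets n × v ≡ inside ∷ p)
  disjoint (_ , _ , refl) (_ , _ , ())

module _ {A : Set} {P : Unary.Pred A 0ℓ} (P? : Unary.Decidable P) where

  ∈-refinements⁻ : ∀ {r} xs → r List.∈ refinements P? xs → value r List.∈ xs
  ∈-refinements⁻ (x ∷ xs) r∈ with P? x
  ∈-refinements⁻ (x ∷ xs) (here refl) | yes _ = here refl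
  ∈-refinements⁻ (x ∷ xs) (there r∈)  | yes _ = there (∈-refinements⁻ xs r∈)
  ∈-refinements⁻ (x ∷ xs) r∈          | no _  = there (∈-refinements⁻ xs r∈)

  refinements-unique : ∀ {xs} → Unique xs → Unique (refinements P? xs)
  refinements-unique {[]}     [] = []
  refinements-unique {x ∷ xs} (x∉ ∷ xs!) with P? x
  ... | yes _ = All.tabulate (λ r∈ eq → All.lookup x∉ (∈-refinements⁻ xs r∈) (cong value eq))
              ∷ refinements-unique xs!
  ... | no _  = refinements-unique xs!

-- Cardinality of a subset through a list of its elements.

elements : ∀ {n} → Subset n → List (Fin n)
elements []            = []
elements (outside ∷ p) = List.map suc (elements p)
elements (inside ∷ p)  = zero ∷ List.map suc (elements p)

length-elements : ∀ {n} (p : Subset n) → length (elements p) ≡ ∣ p ∣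
length-elements []            = refl
length-elements (outside ∷ p) = trans (length-map suc (elements p)) (length-elements p)
length-elements (inside ∷ p)  = cong suc (trans (length-map suc (elements p)) (length-elements p))

∈-elements⁺ : ∀ {n} {p : Subset n} {x} → x ∈ p → x List.∈ elements p
∈-elements⁺ {p = inside ∷ p}  here       = here refl
∈-elements⁺ {p = inside ∷ p}  (there x∈) = there (∈-map⁺ suc (∈-elements⁺ x∈))
∈-elements⁺ {p = outside ∷ p} (there x∈) = ∈-map⁺ suc (∈-elements⁺ x∈)

∈-elements⁻ : ∀ {n} (p : Subset n) {x} → x List.∈ elements p → x ∈ p
∈-elements⁻ (outside ∷ p) x∈ with ∈-map⁻ suc x∈
... | _ , y∈ , refl = there (∈-elements⁻ p y∈)
∈-elements⁻ (inside ∷ p) (here refl) = here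
∈-elements⁻ (inside ∷ p) (there x∈) with ∈-map⁻ suc x∈
... | _ , y∈ , refl = there (∈-elements⁻ p y∈)

elements-unique : ∀ {n} (p : Subset n) → Unique (elements p)
elements-unique []            = []
elements-unique (outside ∷ p) = Unique.map⁺ (λ { refl → refl }) (elements-unique p)
elements-unique (inside ∷ p)  =
  All.tabulate (λ x∈ eq → contradiction (∈-map⁻ suc x∈) λ { (_ , _ , refl) → contradiction eq λ () })
  ∷ Unique.map⁺ (λ { refl → refl }) (elements-unique p)

∣∣≡length : ∀ {n} {p : Subset n} {xs} → Unique xs → (∀ {x} → x ∈ p ⇔ x List.∈ xs) → ∣ p ∣ ≡ length xs
∣∣≡length {p = p} xs! p∼xs = trans (sym (length-elements p))
  (↭.↭-length (↭-from-set (elements-unique p) xs!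
    (mk⇔ (Equivalence.to p∼xs ∘ ∈-elements⁻ p) (∈-elements⁺ ∘ Equivalence.from p∼xs))))

-- Cycles of an injective map.

-- The field `first` makes `suc t` the least period. `N` is tied to it only by an equation, so that
-- it can be a closed formula in a.
record Period {X : Set} (f : X → X) (size : X → ℕ) (x : X) (N W : ℕ) : Set where
  field
    t       : ℕ
    length≡ : N ≡ suc t
    return  : fold x f (suc t) ≡ x
    first   : ¬ x List.∈ iterate f (f x) t
    size≡   : size x + sum (List.map size (iterate f (f x) t)) ≡ W

module Cycle {X : Set} (f : X → X) (f-injective : ∀ {x y} → f x ≡ f y → x ≡ y) where

  _∼_ : X → X → Set
  _∼_ = EqClosure (λ x y → f x ≡ y)

  iterate-map : ∀ x m → iterate f (f x) m ≡ List.map f (iterate f x m)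
  iterate-map x zero    = refl
  iterate-map x (suc m) = cong (f x ∷_) (iterate-map (f x) m)

  fold-suc : ∀ x m → fold (f x) f m ≡ f (fold x f m)
  fold-suc x zero    = refl
  fold-suc x (suc m) = cong f (fold-suc x m)

  ∈-iterate-suc⁻ : ∀ {y} x m → y List.∈ iterate f x (suc m) → y List.∈ iterate f x m ⊎ y ≡ fold x f m
  ∈-iterate-suc⁻ x zero    (here refl) = inj₂ refl
  ∈-iterate-suc⁻ x (suc m) (here refl) = inj₁ (here refl)
  ∈-iterate-suc⁻ x (suc m) (there y∈) with ∈-iterate-suc⁻ (f x) m y∈
  ... | inj₁ y∈′ = inj₁ (there y∈′)
  ... | inj₂ eq  = inj₂ (trans eq (fold-suc x m))

  ∈-iterate-suc⁺ : ∀ {y} x m → y List.∈ iterate f x m → y List.∈ iterate f x (suc m)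
  ∈-iterate-suc⁺ x (suc m) (here refl) = here refl
  ∈-iterate-suc⁺ x (suc m) (there y∈)  = there (∈-iterate-suc⁺ (f x) m y∈)

  fold∈iterate : ∀ x m → fold x f m List.∈ iterate f x (suc m)
  fold∈iterate x zero    = here refl
  fold∈iterate x (suc m) = there
    (subst (List._∈ iterate f (f x) (suc m)) (fold-suc x m) (fold∈iterate (f x) m))

  ∈-iterate⇒∼ : ∀ {y} x m → y List.∈ iterate f x m → x ∼ y
  ∈-iterate⇒∼ x (suc m) (here refl) = ε
  ∈-iterate⇒∼ x (suc m) (there y∈)  = fwd refl ◅ ∈-iterate⇒∼ (f x) m y∈

  -- If `f x` recurred, injectivity would pull the recurrence back to `x` one step earlier. Hence
  -- excluding returns to the starting point is enough.
  iterate-unique : ∀ x m → ¬ x List.∈ iterate f (f x) m → Unique (iterate f x (suc m))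
  iterate-unique x zero    x∉ = [] ∷ []
  iterate-unique x (suc m) x∉ =
    All.tabulate (λ y∈ eq → x∉ (subst (List._∈ iterate f (f x) (suc m)) (sym eq) y∈))
    ∷ iterate-unique (f x) m fx∉
    where
    fx∉ : ¬ f x List.∈ iterate f (f (f x)) m
    fx∉ fx∈ with ∈-map⁻ f (subst (f x List.∈_) (iterate-map (f x) m) fx∈)
    ... | y , y∈ , eq = x∉ (subst (List._∈ iterate f (f x) (suc m)) (sym (f-injective eq))
                          (∈-iterate-suc⁺ (f x) m y∈))

  module _ {z m} (return : fold z f (suc m) ≡ z) where

    private
      cycle = iterate f z (suc m)

    cycle⁺ : ∀ {y} → y List.∈ cycle → f y List.∈ cycle
    cycle⁺ {y} y∈ with ∈-iterate-suc⁻ (f z) m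
      (subst (f y List.∈_) (sym (iterate-map z (suc m))) (∈-map⁺ f y∈))
    ... | inj₁ fy∈ = there fy∈
    ... | inj₂ eq  = here (trans eq (trans (fold-suc z m) return))

    -- A cycle that returns equals its image under `f`, so `f y` is the image of a point of the
    -- cycle, which injectivity identifies with `y`. This handles the backward edges of `∼`.
    cycle⁻ : ∀ {y} → f y List.∈ cycle → y List.∈ cycle
    cycle⁻ {y} fy∈ with ∈-map⁻ f (subst (f y List.∈_) (iterate-map z (suc m)) (shifted fy∈))
      where
      shifted : ∀ {x} → x List.∈ cycle → x List.∈ iterate f (f z) (suc m)
      shifted (here refl) = subst (List._∈ iterate f (f z) (suc m)) (trans (fold-suc z m) return)
                              (fold∈iterate (f z) m)
      shifted (there x∈)  = ∈-iterate-suc⁺ (f z) m x∈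
    ... | x , x∈ , eq = subst (List._∈ cycle) (sym (f-injective eq)) x∈

    cycle-closed : ∀ {x y} → x ∼ y → x List.∈ cycle → y List.∈ cycle
    cycle-closed ε               x∈ = x∈
    cycle-closed (fwd refl ◅ ps) x∈ = cycle-closed ps (cycle⁺ x∈)
    cycle-closed (bwd refl ◅ ps) x∈ = cycle-closed ps (cycle⁻ x∈)

    ∼⇔∈cycle : ∀ {y} → z ∼ y ⇔ y List.∈ cycle
    ∼⇔∈cycle = mk⇔ (λ z∼y → cycle-closed z∼y (here refl)) (∈-iterate⇒∼ z (suc m))

-- Size and χ of an orbit from a period.

module OrbitStatistics {n : ℕ} {_⊑_ : Rel (Fin n) 0ℓ}
                       (isDecPartialOrder : IsDecPartialOrder _≡_ _⊑_) where

  private module ⊑ = IsDecPartialOrder isDecPartialOrder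
  open Rowmotion isDecPartialOrder

  -- The closure proof carried by an ideal is irrelevant; it becomes usable because membership is
  -- decidable.
  ideal-closed : (I : Ideal) → ∀ {x y} → y ∈ value I → x ⊑ y → x ∈ value I
  ideal-closed (I , [ closed ]) {x} {y} y∈ x⊑y with x ∈? I
  ... | yes x∈ = x∈
  ... | no  x∉ = ⊥-elim-irr (x∉ (closed x y y∈ x⊑y))

  antichain-≡ : (A : Antichain) → ∀ {x y} → x ∈ value A → y ∈ value A → x ⊑ y → x ≡ y
  antichain-≡ (A , [ antichain ]) {x} {y} x∈ y∈ x⊑y with x ⊑.≟ y
  ... | yes x≡y = x≡y
  ... | no  x≢y = ⊥-elim-irr (x≢y (antichain x y x∈ y∈ x⊑y))

  -- An x in A lies below some y in B, which lies below some z in A. The antichain property gives x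
  -- = z, and antisymmetry then gives x = y.
  ⟨⟩-reflects-⊆ : ∀ A B → (∀ {x} → x ∈ value ⟨ A ⟩ → x ∈ value ⟨ B ⟩) →
                  (∀ {x} → x ∈ value ⟨ B ⟩ → x ∈ value ⟨ A ⟩) →
                  ∀ {x} → x ∈ value A → x ∈ value B
  ⟨⟩-reflects-⊆ A B A⊆B B⊆A {x} x∈A
    with ∈⟦⟧⁻ (isBelow? (value B)) (A⊆B (∈⟦⟧⁺ (isBelow? (value A)) (x , x∈A , ⊑.refl)))
  ... | y , y∈B , x⊑y
    with ∈⟦⟧⁻ (isBelow? (value A)) (B⊆A (∈⟦⟧⁺ (isBelow? (value B)) (y , y∈B , ⊑.refl)))
  ... | z , z∈A , y⊑z with antichain-≡ A x∈A z∈A (⊑.trans x⊑y y⊑z)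
  ... | refl = subst (_∈ value B) (⊑.antisym y⊑z x⊑y) y∈B

  ⟨⟩-injective : ∀ {A B} → (∀ {x} → x ∈ value ⟨ A ⟩ ⇔ x ∈ value ⟨ B ⟩) → A ≡ B
  ⟨⟩-injective {A} {B} A∼B = Refinement.value-injective (⊆-antisym
    (⟨⟩-reflects-⊆ A B (Equivalence.to A∼B) (Equivalence.from A∼B))
    (⟨⟩-reflects-⊆ B A (Equivalence.from A∼B) (Equivalence.to A∼B)))

  antichains-unique : Unique antichains
  antichains-unique = refinements-unique isAntichain? (subsets-unique n)

  ∈-antichains : ∀ A → A List.∈ antichains
  ∈-antichains A = ∈-refinements isAntichain? A (∈-subsets (value A))

  size : Antichain → ℕ
  size A = ∣ value A ∣

  module _ (ρ-injective : ∀ {A B} → ρ A ≡ ρ B → A ≡ B)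
           {Z N W} (period : Period ρ size Z N W) where

    open Cycle ρ ρ-injective hiding (_∼_)
    open Period period

    orbit-↭ : ∀ {A} → Z ∼ A → orbit A ↭ iterate ρ Z (suc t)
    orbit-↭ {A} Z∼A = filter-↭ (A ∼?_) antichains-unique ∈-antichains (iterate-unique Z t first)
      (λ {B} → mk⇔ (λ A∼B → Equivalence.to (∼⇔∈cycle {Z} {t} return {B}) (Z∼A ◅◅ A∼B))
                   (λ B∈ → Eq.symmetric _ Z∼A ◅◅ Equivalence.from (∼⇔∈cycle {Z} {t} return {B}) B∈))

    #-period : ∀ {A} → Z ∼ A → # A ≡ N
    #-period Z∼A = trans (trans (↭.↭-length (orbit-↭ Z∼A)) (length-iterate ρ Z (suc t))) (sym length≡)

    χ-period : ∀ {A} → Z ∼ A → χ A ≡ W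
    χ-period Z∼A = trans (sum-↭ (↭.map⁺ size (orbit-↭ Z∼A))) size≡

-- Coordinates on the fence: a maximal chain and a height.

data Chain : Set where
  l m r : Chain

-- The size a₀ of the fence is only propositionally a successor: with n a successor,
-- conversion checking would unfold the enumeration of the subsets of Fin n.
module Coordinates {a₀ b : ℕ} (a₀≡ : a₀ ≡ suc b) where

  a = suc b

  open Fence a₀

  off len : Chain → ℕ
  off l = 0
  off m = a
  off r = a + suc a
  len l = a
  len m = suc a
  len r = a

  -- Heights count from 0 at the bottom of the chain, so an ideal with k elements on the chain
  -- contains the point at height p exactly when p < k.
  record At (x : Fin n) (c : Chain) (p : ℕ) : Set where
    constructor at
    field
      toℕ≡ : toℕ x ≡ off c + p
      p<   : p < len c

  2a+1 : 2 * a₀ + 1 ≡ a + suc a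
  2a+1 = trans (cong (λ a → 2 * a + 1) a₀≡) (lemma a)
    where
    lemma : ∀ a → 2 * a + 1 ≡ a + suc a
    lemma = solve-∀

  n≡ : n ≡ off r + len r
  n≡ = trans (cong (λ a → 3 * a + 1) a₀≡) (lemma a)
    where
    lemma : ∀ a → 3 * a + 1 ≡ a + suc a + a
    lemma = solve-∀

  off+len≤n : ∀ c → off c + len c ≤ n
  off+len≤n c rewrite n≡ = lemma c
    where
    lemma : ∀ c → off c + len c ≤ off r + len r
    lemma l = ℕ.≤-trans (ℕ.m≤m+n a (suc a)) (ℕ.m≤m+n (a + suc a) a)
    lemma m = ℕ.m≤m+n (a + suc a) a
    lemma r = ℕ.≤-refl

  point : ∀ c {p} → p < len c → ∃ λ x → At x c p
  point c {p} p< = fromℕ< bound , at (Fin.toℕ-fromℕ< bound) p<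
    where
    bound : off c + p < n
    bound = ℕ.<-≤-trans (ℕ.+-monoʳ-< (off c) p<) (off+len≤n c)

  locate : ∀ x → ∃₂ λ c p → At x c p
  locate x with toℕ x ℕ.<? a
  ... | yes x<a = l , toℕ x , at refl x<a
  ... | no  x≮a with toℕ x ∸ a ℕ.<? suc a
  ...   | yes p< = m , toℕ x ∸ a , at (sym (ℕ.m+[n∸m]≡n (ℕ.≮⇒≥ x≮a))) p<
  ...   | no  p≮ = r , toℕ x ∸ off r , at (sym eq)
            (ℕ.+-cancelˡ-< (off r) _ _
              (ℕ.≤-<-trans (ℕ.≤-reflexive eq) (subst (toℕ x <_) n≡ (Fin.toℕ<n x))))
    where
    eq : off r + (toℕ x ∸ off r) ≡ toℕ x
    eq = ℕ.m+[n∸m]≡n (ℕ.≤-trans (ℕ.+-monoʳ-≤ a (ℕ.≮⇒≥ p≮)) (ℕ.≤-reflexive (ℕ.m+[n∸m]≡n (ℕ.≮⇒≥ x≮a))))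

  data Before : Chain → Chain → Set where
    l<m : Before l m
    l<r : Before l r
    m<r : Before m r

  before-apart : ∀ {c c′ p q} → Before c c′ → p < len c → off c + p ≢ off c′ + q
  before-apart {p = p} {q} lt p< = ℕ.<⇒≢ (ℕ.<-≤-trans (ℕ.+-monoʳ-< _ p<) (bound lt))
    where
    bound : ∀ {c c′} → Before c c′ → off c + len c ≤ off c′ + q
    bound l<m = ℕ.m≤m+n a q
    bound l<r = ℕ.≤-trans (ℕ.m≤m+n a (suc a)) (ℕ.m≤m+n (a + suc a) q)
    bound m<r = ℕ.m≤m+n (a + suc a) q

  At-functional : ∀ {x c p c′ q} → At x c p → At x c′ q → c ≡ c′ × p ≡ q
  At-functional {x} {c} {p} {c′} {q} (at eq p<) (at eq′ q<) = cases c c′ p< q< (trans (sym eq) eq′)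
    where
    same : ∀ c → off c + p ≡ off c + q → c ≡ c × p ≡ q
    same c e = refl , ℕ.+-cancelˡ-≡ (off c) p q e
    cases : ∀ c c′ → p < len c → q < len c′ → off c + p ≡ off c′ + q → c ≡ c′ × p ≡ q
    cases l l _  _  e = same l e
    cases m m _  _  e = same m e
    cases r r _  _  e = same r e
    cases l m p< _  e = contradiction e (before-apart l<m p<)
    cases l r p< _  e = contradiction e (before-apart l<r p<)
    cases m r p< _  e = contradiction e (before-apart m<r p<)
    cases m l _  q< e = contradiction (sym e) (before-apart l<m q<)
    cases r l _  q< e = contradiction (sym e) (before-apart l<r q<)
    cases r m _  q< e = contradiction (sym e) (before-apart m<r q<)

  At-injective : ∀ {x y c p} → At x c p → At y c p → x ≡ y
  At-injective (at eq _) (at eq′ _) = Fin.toℕ-injective (trans eq (sym eq′))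

  -- The smaller point comes first. `ml` is the descent from x_a to x_{a+1}, and `rm` the one from
  -- x_{2a+1} to x_{2a+2}.
  data Cover : Chain → ℕ → Chain → ℕ → Set where
    up : ∀ {c p} → Cover c p c (suc p)
    ml : Cover m 0 l b
    rm : Cover r 0 m a

  last-l : ∀ {x} → index x ≡ a₀ → At x l b
  last-l eq = at (ℕ.suc-injective (trans eq a₀≡)) ℕ.≤-refl

  last-m : ∀ {x} → index x ≡ 2 * a₀ + 1 → At x m a
  last-m eq = at (ℕ.suc-injective (trans eq (trans 2a+1 (ℕ.+-suc a a)))) ℕ.≤-refl

  first-m : ∀ {x} → index x ≡ suc a₀ → At x m 0
  first-m eq = at (trans (trans (ℕ.suc-injective eq) a₀≡) (sym (ℕ.+-identityʳ a))) (s≤s z≤n)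

  first-r : ∀ {x} → index x ≡ suc (2 * a₀ + 1) → At x r 0
  first-r eq = at (trans (ℕ.suc-injective eq) (trans 2a+1 (sym (ℕ.+-identityʳ (off r))))) (s≤s z≤n)

  top-peak : ∀ {x c p} → At x c p → suc p ≡ len c → c ≢ r → Peak (index x)
  top-peak {c = l} (at eq _) refl _ = inj₁ (trans (cong suc eq) (sym a₀≡))
  top-peak {c = m} (at eq _) refl _ = inj₂ (trans (cong suc eq) (trans (sym (ℕ.+-suc a a)) (sym 2a+1)))
  top-peak {c = r} _ _ c≢r = contradiction refl c≢r

  cover⁻ : ∀ {x y c p c′ q} → x ⋖ y → At x c p → At y c′ q → Cover c p c′ q
  cover⁻ {x} {y} {c} {p} (inj₁ (eq , ¬peak)) x∈@(at eqx p<) y∈ with suc p ℕ.<? len c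
  ... | yes sp< with At-functional y∈
                      (at (trans (ℕ.suc-injective eq) (trans (cong suc eqx) (sym (ℕ.+-suc (off c) p)))) sp<)
  ...   | refl , refl = up
  cover⁻ {x} {y} {c} {p} (inj₁ (eq , ¬peak)) x∈@(at eqx p<) y∈ | no sp≮ =
    contradiction (top-peak x∈ top c≢r) ¬peak
    where
    top : suc p ≡ len c
    top = ℕ.≤-antisym p< (ℕ.≮⇒≥ sp≮)
    -- Above the top of the last chain, `toℕ y` would have to be n.
    c≢r : c ≢ r
    c≢r refl = ℕ.<⇒≢ (Fin.toℕ<n y) (trans (ℕ.suc-injective eq)
      (trans (cong suc eqx) (trans (sym (ℕ.+-suc (off r) p)) (trans (cong (off r +_) top) (sym n≡)))))
  cover⁻ (inj₂ (eq , inj₁ peak)) x∈ y∈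
    with At-functional y∈ (last-l peak) | At-functional x∈ (first-m (trans eq (cong suc peak)))
  ... | refl , refl | refl , refl = ml
  cover⁻ (inj₂ (eq , inj₂ peak)) x∈ y∈
    with At-functional y∈ (last-m peak) | At-functional x∈ (first-r (trans eq (cong suc peak)))
  ... | refl , refl | refl , refl = rm

  cover⁺ : ∀ {x y c p c′ q} → Cover c p c′ q → At x c p → At y c′ q → x ⋖ y
  cover⁺ {x} {c = c} {p} up x∈@(at eqx _) (at eqy sp<) =
    inj₁ (cong suc (trans eqy (trans (ℕ.+-suc (off c) p) (cong suc (sym eqx)))) , ¬peak)
    where
    ¬peak : ¬ Peak (index x)
    ¬peak (inj₁ eq) with At-functional x∈ (last-l eq)
    ... | refl , refl = ℕ.n≮n _ sp<
    ¬peak (inj₂ eq) with At-functional x∈ (last-m eq)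
    ... | refl , refl = ℕ.n≮n _ sp<
  cover⁺ ml x∈@(at eqx _) y∈@(at eqy _) =
    inj₂ (cong suc (trans eqx (trans (ℕ.+-identityʳ a) (cong suc (sym eqy)))) , top-peak y∈ refl λ ())
  cover⁺ rm x∈@(at eqx _) y∈@(at eqy _) =
    inj₂ (cong suc (trans eqx (trans (ℕ.+-identityʳ (off r)) (trans (ℕ.+-suc a a) (cong suc (sym eqy))))) ,
      top-peak y∈ refl λ ())

  chain-⊑ : ∀ {x y c p q} → At x c p → At y c q → p ≤ q → x ⊑ y
  chain-⊑ {x} {y} {c} {p} {q} x∈ y∈ p≤q =
    subst (λ q → ∀ {y} → At y c q → x ⊑ y) (ℕ.m∸n+n≡m p≤q) (climb (q ∸ p)) y∈
    where
    climb : ∀ k {y} → At y c (k + p) → x ⊑ y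
    climb zero    y∈ with At-injective x∈ y∈
    ... | refl = ε
    climb (suc k) y∈@(at _ sp<) with point c (ℕ.<-trans (ℕ.n<1+n _) sp<)
    ... | z , z∈ = climb k z∈ ◅◅ (cover⁺ up z∈ y∈ ◅ ε)

-- An ideal is encoded by the numbers of its elements on the three maximal chains.
record State : Set where
  constructor st
  field lo mid hi : ℕ
open State

_!_ : State → Chain → ℕ
st i j k ! l = i
st i j k ! m = j
st i j k ! r = k

-- Rowmotion as a transition system on triples.

module Dynamics (b : ℕ) where

  a = suc b

  -- The last two fields express closure under the two descents: x_a requires x_{a+1}, and x_{2a+1}
  -- requires x_{2a+2}.
  record Legal (s : State) : Set where
    constructor legal
    field
      lo≤  : lo s ≤ a
      mid≤ : mid s ≤ suc a
      hi≤  : hi s ≤ a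
      lo⇒mid : lo s ≡ a → 0 < mid s
      mid⇒hi : mid s ≡ suc a → 0 < hi s

  -- In `skip` the lowest missing point is x_a, which is not minimal because x_{a+1} is missing too.
  -- The value becomes 0, since no point of another chain lies above the first chain.
  data StepI (j : ℕ) : ℕ → ℕ → ℕ → Set where
    rise : ∀ {i} → i < a → (i ≡ b → 0 < j) → StepI j i (suc i) 1
    skip : j ≡ 0 → StepI j b 0 0
    fall : StepI j a 0 0

  Stuck : ℕ → ℕ → Set
  Stuck j k = (j ≡ a × k ≡ 0) ⊎ j ≡ suc a

  -- If the first chain has just been completed, x_a is a generator and lies above x_{a+1}; so a
  -- stuck second chain keeps this one point. The parameter `k` is the old value, `i′` the new one.
  data StepJ (k i′ : ℕ) : ℕ → ℕ → ℕ → Set where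
    rise : ∀ {j} → j ≤ a → (j ≡ a → 0 < k) → StepJ k i′ j (suc j) 1
    drop : ∀ {j} → Stuck j k → i′ ≢ a → StepJ k i′ j 0 0
    push : ∀ {j} → Stuck j k → i′ ≡ a → StepJ k i′ j 1 0

  data StepK (j′ : ℕ) : ℕ → ℕ → ℕ → Set where
    rise : ∀ {k} → k < a → StepK j′ k (suc k) 1
    fall : j′ ≢ suc a → StepK j′ a 0 0
    push : j′ ≡ suc a → StepK j′ a 1 0

  -- The weight of a step counts the minimal elements of the complement of the ideal.
  data Step : State → ℕ → State → Set where
    step : ∀ {i j k i′ j′ k′ u v w} → StepI j i i′ u → StepJ k i′ j j′ v → StepK j′ k k′ w →
           Step (st i j k) (u + (v + w)) (st i′ j′ k′)

  step-legal : ∀ {s w t} → Step s w t → Legal t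
  step-legal (step {i′ = i′} {j′} {k′} I J K) = legal (boundI I) (boundJ J) (boundK K) (I⇒J J) (J⇒K K)
    where
    boundI : ∀ {j i i′ u} → StepI j i i′ u → i′ ≤ a
    boundI (rise i< _) = i<
    boundI (skip _)    = z≤n
    boundI fall        = z≤n
    boundJ : ∀ {k i′ j j′ v} → StepJ k i′ j j′ v → j′ ≤ suc a
    boundJ (rise j≤ _) = s≤s j≤
    boundJ (drop _ _)  = z≤n
    boundJ (push _ _)  = s≤s z≤n
    boundK : ∀ {j′ k k′ w} → StepK j′ k k′ w → k′ ≤ a
    boundK (rise k<) = k<
    boundK (fall _)  = z≤n
    boundK (push _)  = s≤s z≤n
    I⇒J : ∀ {k i′ j j′ v} → StepJ k i′ j j′ v → i′ ≡ a → 0 < j′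
    I⇒J (rise _ _)   _  = s≤s z≤n
    I⇒J (drop _ i′≢) eq = contradiction eq i′≢
    I⇒J (push _ _)   _  = s≤s z≤n
    J⇒K : ∀ {j′ k k′ w} → StepK j′ k k′ w → j′ ≡ suc a → 0 < k′
    J⇒K (rise _)    _  = s≤s z≤n
    J⇒K (fall j′≢)  eq = contradiction eq j′≢
    J⇒K (push _)    _  = s≤s z≤n

  stepI-total : ∀ j {i} → i ≤ a → ∃₂ (StepI j i)
  stepI-total j {i} i≤ with ℕ.m≤n⇒m<n∨m≡n i≤
  ... | inj₂ refl = 0 , 0 , fall
  ... | inj₁ i< with i ℕ.≟ b
  ...   | no i≢b = suc i , 1 , rise i< (λ eq → contradiction eq i≢b)
  stepI-total zero    i≤ | inj₁ i< | yes refl = 0 , 0 , skip refl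
  stepI-total (suc j) i≤ | inj₁ i< | yes refl = a , 1 , rise i< (λ _ → s≤s z≤n)

  stepJ-total : ∀ k i′ {j} → j ≤ suc a → ∃₂ (StepJ k i′ j)
  stepJ-total k i′ {j} j≤ = decide (ℕ.m≤n⇒m<n∨m≡n j≤)
    where
    stuck : Stuck j k → ∃₂ (StepJ k i′ j)
    stuck p with i′ ℕ.≟ a
    ... | yes eq = 1 , 0 , push p eq
    ... | no i′≢ = 0 , 0 , drop p i′≢
    decide : j < suc a ⊎ j ≡ suc a → ∃₂ (StepJ k i′ j)
    decide (inj₂ eq) = stuck (inj₂ eq)
    decide (inj₁ (s≤s j≤a)) with j ℕ.≟ a | k ℕ.≟ 0
    ... | no j≢a | _      = suc j , 1 , rise j≤a (λ eq → contradiction eq j≢a)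
    ... | yes eq | yes k0 = stuck (inj₁ (eq , k0))
    ... | yes eq | no k≢0 = suc j , 1 , rise j≤a (λ _ → ℕ.n≢0⇒n>0 k≢0)

  stepK-total : ∀ j′ {k} → k ≤ a → ∃₂ (StepK j′ k)
  stepK-total j′ {k} k≤ with ℕ.m≤n⇒m<n∨m≡n k≤
  ... | inj₁ k<   = suc k , 1 , rise k<
  ... | inj₂ refl with j′ ℕ.≟ suc a
  ...   | yes eq = 1 , 0 , push eq
  ...   | no j′≢ = 0 , 0 , fall j′≢

  step-total : ∀ {s} → Legal s → ∃₂ λ w t → Step s w t
  step-total {st i j k} (legal i≤ j≤ k≤ _ _) with stepI-total j i≤
  ... | i′ , u , I with stepJ-total k i′ j≤
  ...   | j′ , v , J with stepK-total j′ k≤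
  ...     | k′ , w , K = u + (v + w) , st i′ j′ k′ , step I J K

  stepI-functional : ∀ {j i i₁ i₂ u₁ u₂} → StepI j i i₁ u₁ → StepI j i i₂ u₂ → i₁ ≡ i₂
  stepI-functional (rise _ _)   (rise _ _)   = refl
  stepI-functional (rise _ 0<j) (skip refl)  = contradiction (0<j refl) λ ()
  stepI-functional (rise i< _)  fall         = contradiction i< (ℕ.n≮n _)
  stepI-functional (skip refl)  (rise _ 0<j) = contradiction (0<j refl) λ ()
  stepI-functional (skip _)     (skip _)     = refl
  stepI-functional fall         (rise i< _)  = contradiction i< (ℕ.n≮n _)
  stepI-functional fall         fall         = refl

  ¬rise-stuck : ∀ {j k} → j ≤ a → (j ≡ a → 0 < k) → ¬ Stuck j k
  ¬rise-stuck j≤ 0<k (inj₁ (eq , refl)) = contradiction (0<k eq) λ ()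
  ¬rise-stuck j≤ 0<k (inj₂ refl)        = ℕ.n≮n _ j≤

  stepJ-functional : ∀ {k i′ j j₁ j₂ v₁ v₂} → StepJ k i′ j j₁ v₁ → StepJ k i′ j j₂ v₂ → j₁ ≡ j₂
  stepJ-functional (rise _ _)   (rise _ _)   = refl
  stepJ-functional (rise j≤ 0<) (drop p _)   = contradiction p (¬rise-stuck j≤ 0<)
  stepJ-functional (rise j≤ 0<) (push p _)   = contradiction p (¬rise-stuck j≤ 0<)
  stepJ-functional (drop p _)   (rise j≤ 0<) = contradiction p (¬rise-stuck j≤ 0<)
  stepJ-functional (drop _ _)   (drop _ _)   = refl
  stepJ-functional (drop _ i≢)  (push _ eq)  = contradiction eq i≢
  stepJ-functional (push p _)   (rise j≤ 0<) = contradiction p (¬rise-stuck j≤ 0<)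
  stepJ-functional (push _ eq)  (drop _ i≢)  = contradiction eq i≢
  stepJ-functional (push _ _)   (push _ _)   = refl

  stepK-functional : ∀ {j′ k k₁ k₂ w₁ w₂} → StepK j′ k k₁ w₁ → StepK j′ k k₂ w₂ → k₁ ≡ k₂
  stepK-functional (rise _)  (rise _)  = refl
  stepK-functional (rise k<) (fall _)  = contradiction k< (ℕ.n≮n _)
  stepK-functional (rise k<) (push _)  = contradiction k< (ℕ.n≮n _)
  stepK-functional (fall _)  (rise k<) = contradiction k< (ℕ.n≮n _)
  stepK-functional (fall _)  (fall _)  = refl
  stepK-functional (fall j≢) (push eq) = contradiction eq j≢
  stepK-functional (push _)  (rise k<) = contradiction k< (ℕ.n≮n _)
  stepK-functional (push eq) (fall j≢) = contradiction eq j≢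
  stepK-functional (push _)  (push _)  = refl

  step-functional : ∀ {s w₁ w₂ t₁ t₂} → Step s w₁ t₁ → Step s w₂ t₂ → t₁ ≡ t₂
  step-functional (step I J K) (step I′ J′ K′) with stepI-functional I I′
  ... | refl with stepJ-functional J J′
  ...   | refl with stepK-functional K K′
  ...     | refl = refl

  comp : State → State
  comp (st i j k) = st (a ∸ k) (suc a ∸ j) (a ∸ i)

  a∸suc< : ∀ k → a ∸ suc k < a
  a∸suc< k = s≤s (ℕ.m∸n≤m b k)

  suc-∸ : ∀ {k N} → k < N → N ∸ k ≡ suc (N ∸ suc k)
  suc-∸ (s≤s k≤) = ℕ.+-∸-assoc 1 k≤

  comp-legal : ∀ {s} → Legal s → Legal (comp s)
  comp-legal {st i j k} (legal i≤ j≤ k≤ i⇒j j⇒k) = legal (ℕ.m∸n≤m a k) (ℕ.m∸n≤m (suc a) j) (ℕ.m∸n≤m a i)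
    (λ eq → ℕ.m<n⇒0<n∸m (ℕ.≤∧≢⇒< j≤ (λ j≡ → ℕ.<⇒≢ (j⇒k j≡) (sym (ℕ.∸-cancelˡ-≡ k≤ z≤n eq)))))
    (λ eq → ℕ.m<n⇒0<n∸m (ℕ.≤∧≢⇒< i≤ (λ i≡ → ℕ.<⇒≢ (i⇒j i≡) (sym (ℕ.∸-cancelˡ-≡ j≤ z≤n eq)))))

  comp-involutive : ∀ {s} → Legal s → comp (comp s) ≡ s
  comp-involutive (legal i≤ j≤ k≤ _ _)
    rewrite ℕ.m∸[m∸n]≡n i≤ | ℕ.m∸[m∸n]≡n j≤ | ℕ.m∸[m∸n]≡n k≤ = refl

  -- Reversed and complemented, a move of the third chain is a move of the first: `push` turns into
  -- `skip`. A rise from k = 0 becomes a rise to x_a, which is permitted because a second chain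
  -- facing an empty third one cannot have risen to a + 1.
  comp-stepI : ∀ {k i′ j j′ k′ v w} → StepJ k i′ j j′ v → StepK j′ k k′ w →
               ∃ (StepI (suc a ∸ j′) (a ∸ k′) (a ∸ k))
  comp-stepI {k} {j′ = j′} J (rise k<) rewrite suc-∸ k< = 1 , rise (a∸suc< k)
    λ eq → ℕ.m<n⇒0<n∸m (bound J (ℕ.∸-cancelˡ-≡ (ℕ.≤-pred k<) z≤n eq))
    where
    bound : ∀ {i′ j j′ v} → StepJ k i′ j j′ v → k ≡ 0 → j′ < suc a
    bound (rise j≤ 0<k) refl = s≤s (ℕ.≤∧≢⇒< j≤ (λ eq → contradiction (0<k eq) λ ()))
    bound (drop _ _)    _    = s≤s z≤n
    bound (push _ _)    _    = s≤s (s≤s z≤n)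
  comp-stepI J (fall _)    rewrite ℕ.n∸n≡0 a = 0 , fall
  comp-stepI J (push refl) rewrite ℕ.n∸n≡0 a = 0 , skip refl

  -- Reversal exchanges the cause and the outcome for a stuck second chain: being full corresponds
  -- to `drop`, being blocked by an empty third chain to `push`.
  comp-stuck : ∀ {i k j j′} → k ≤ a → (j ≡ suc a → 0 < k) → Stuck j k → Stuck j′ i →
               StepJ i (a ∸ k) j′ (suc a ∸ j) 0
  comp-stuck k≤ j⇒k (inj₁ (refl , refl)) stuck
    rewrite ℕ.+-∸-assoc 1 (ℕ.≤-refl {a}) | ℕ.n∸n≡0 a = push stuck refl
  comp-stuck k≤ j⇒k (inj₂ refl) stuck
    rewrite ℕ.n∸n≡0 a = drop stuck (λ eq → ℕ.<⇒≢ (j⇒k refl) (sym (ℕ.∸-cancelˡ-≡ k≤ z≤n eq)))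

  comp-stepJ : ∀ {i k i′ j j′ u v} → k ≤ a → (j ≡ suc a → 0 < k) → StepI j i i′ u → StepJ k i′ j j′ v →
               ∃ (StepJ (a ∸ i′) (a ∸ k) (suc a ∸ j′) (suc a ∸ j))
  comp-stepJ {i} k≤ j⇒k I (rise {j} j≤ _) rewrite ℕ.+-∸-assoc 1 j≤ = 1 , rise (ℕ.m∸n≤m a j)
    λ eq → ℕ.m<n⇒0<n∸m (bound I (ℕ.∸-cancelˡ-≡ j≤ z≤n eq))
    where
    bound : ∀ {j i i′ u} → StepI j i i′ u → j ≡ 0 → i′ < a
    bound (rise i< 0<j) refl = s≤s (ℕ.≤∧≢⇒< (ℕ.≤-pred i<) (λ eq → contradiction (0<j eq) λ ()))
    bound (skip _)      _    = s≤s z≤n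
    bound fall          _    = s≤s z≤n
  comp-stepJ {k = k} {i′} {j} k≤ j⇒k I (drop stuck _) =
    0 , comp-stuck k≤ j⇒k stuck (inj₂ refl)
  comp-stepJ {k = k} {i′} {j} k≤ j⇒k I (push stuck refl) =
    0 , comp-stuck k≤ j⇒k stuck (inj₁ (refl , ℕ.n∸n≡0 a))

  comp-stepK : ∀ {j i i′ u} → j ≤ suc a → (i ≡ a → 0 < j) → StepI j i i′ u →
               ∃ (StepK (suc a ∸ j) (a ∸ i′) (a ∸ i))
  comp-stepK j≤ i⇒j (rise {i} i< _) rewrite suc-∸ i< = 1 , rise (a∸suc< i)
  comp-stepK j≤ i⇒j (skip refl) rewrite ℕ.+-∸-assoc 1 (ℕ.≤-refl {b}) | ℕ.n∸n≡0 b = 0 , push refl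
  comp-stepK j≤ i⇒j fall rewrite ℕ.n∸n≡0 a =
    0 , fall (λ eq → ℕ.<⇒≢ (i⇒j refl) (sym (ℕ.∸-cancelˡ-≡ j≤ z≤n eq)))

  step-comp : ∀ {s w t} → Legal s → Step s w t → ∃ λ w′ → Step (comp t) w′ (comp s)
  step-comp (legal _ j≤ k≤ i⇒j j⇒k) (step I J K) =
    _ , step (proj₂ (comp-stepI J K)) (proj₂ (comp-stepJ k≤ j⇒k I J)) (proj₂ (comp-stepK j≤ i⇒j I))

  -- The complement turns steps around, so determinism read backwards is injectivity. In the same
  -- way totality becomes surjectivity below.
  step-injective : ∀ {s₁ s₂ w₁ w₂ t} → Legal s₁ → Legal s₂ → Step s₁ w₁ t → Step s₂ w₂ t → s₁ ≡ s₂
  step-injective L₁ L₂ S₁ S₂ =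
    trans (sym (comp-involutive L₁))
    (trans (cong comp (step-functional (proj₂ (step-comp L₁ S₁)) (proj₂ (step-comp L₂ S₂))))
    (comp-involutive L₂))

  step-surjective : ∀ {t} → Legal t → ∃₂ λ s w → Legal s × Step s w t
  step-surjective {t} L with step-total (comp-legal L)
  ... | w , u , S with step-comp (comp-legal L) S
  ...   | w′ , S′ = comp u , w′ , comp-legal (step-legal S) ,
                    subst (Step (comp u) w′) (comp-involutive L) S′

initial-segment : ∀ {Q : ℕ → Set} N → (∀ {p} → p < N → Dec (Q p)) →
                  (∀ {p q} → p ≤ q → q < N → Q q → Q p) →
                  ∃ λ k → k ≤ N × (∀ {p} → p < N → Q p ⇔ p < k)
initial-segment zero    Q? closed = 0 , z≤n , λ ()
initial-segment {Q} (suc N) Q? closed with Q? (ℕ.n<1+n N)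
... | yes q = suc N , ℕ.≤-refl , λ p< → mk⇔ (λ _ → p<) (λ _ → closed (ℕ.≤-pred p<) (ℕ.n<1+n N) q)
... | no ¬q with initial-segment N (λ p< → Q? (ℕ.m<n⇒m<1+n p<)) (λ p≤q q< → closed p≤q (ℕ.m<n⇒m<1+n q<))
...   | k , k≤N , Q⇔ = k , ℕ.m≤n⇒m≤1+n k≤N , λ p< → extend (ℕ.m≤n⇒m<n∨m≡n (ℕ.≤-pred p<))
  where
  extend : ∀ {p} → p < N ⊎ p ≡ N → Q p ⇔ p < k
  extend (inj₁ p<N)  = Q⇔ p<N
  extend (inj₂ refl) = mk⇔ (λ q → contradiction q ¬q)
    (λ N<k → contradiction (ℕ.<-≤-trans N<k k≤N) (ℕ.n≮n _))

star-last : ∀ {A : Set} {R : Rel A 0ℓ} {x y} → Star R x y → x ≡ y ⊎ ∃ λ z → Star R x z × R z y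
star-last ε = inj₁ refl
star-last (x∼ ◅ xs) with star-last xs
... | inj₁ refl           = inj₂ (_ , ε , x∼)
... | inj₂ (z , xs′ , z∼) = inj₂ (z , x∼ ◅ xs′ , z∼)

-- Ideals of the fence correspond to legal triples.

module Simulation {a₀ b : ℕ} (a₀≡ : a₀ ≡ suc b) where

  open Coordinates a₀≡
  open Fence a₀
  open OrbitStatistics isDecPartialOrder
  open Dynamics b hiding (a)

  record Is (I : Subset n) (s : State) : Set where
    constructor is
    field ∈⇔ : ∀ {x c p} → At x c p → x ∈ I ⇔ p < s ! c
  open Is public

  !≤len : ∀ {s} → Legal s → ∀ c → s ! c ≤ len c
  !≤len L l = Legal.lo≤ L
  !≤len L m = Legal.mid≤ L
  !≤len L r = Legal.hi≤ L

  is-unique : ∀ {I J s} → Is I s → Is J s → ∀ {x} → x ∈ I ⇔ x ∈ J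
  is-unique I-s J-s {x} with locate x
  ... | c , p , x∈ = mk⇔ (Equivalence.from (∈⇔ J-s x∈) ∘ Equivalence.to (∈⇔ I-s x∈))
                         (Equivalence.from (∈⇔ I-s x∈) ∘ Equivalence.to (∈⇔ J-s x∈))

  is-≤ : ∀ {I s t} → Is I s → Is I t → Legal s → ∀ c → s ! c ≤ t ! c
  is-≤ {s = s} {t} I-s I-t L c with s ! c in eq
  ... | zero  = z≤n
  ... | suc p with point c (ℕ.≤-trans (ℕ.≤-reflexive (sym eq)) (!≤len L c))
  ...   | x , x∈ = Equivalence.to (∈⇔ I-t x∈) (Equivalence.from (∈⇔ I-s x∈) (ℕ.≤-reflexive (sym eq)))

  is-functional : ∀ {I s t} → Is I s → Is I t → Legal s → Legal t → s ≡ t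
  is-functional {s = st i j k} {st i′ j′ k′} I-s I-t L L′ =
    st-cong (at! l) (at! m) (at! r)
    where
    at! : ∀ c → st i j k ! c ≡ st i′ j′ k′ ! c
    at! c = ℕ.≤-antisym (is-≤ I-s I-t L c) (is-≤ I-t I-s L′ c)
    st-cong : i ≡ i′ → j ≡ j′ → k ≡ k′ → st i j k ≡ st i′ j′ k′
    st-cong refl refl refl = refl

  ideal-state : (I : Ideal) → ∃ λ s → Legal s × Is (value I) s
  ideal-state I = s , legal (bound l) (bound m) (bound r) lo⇒mid mid⇒hi , is by-chain
    where
    Meets : Chain → ℕ → Set
    Meets c p = ∃ λ x → At x c p × x ∈ value I
    meets? : ∀ c {p} → p < len c → Dec (Meets c p)
    meets? c p< with point c p<
    ... | x , x∈ with x ∈? value I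
    ...   | yes x∈I = yes (x , x∈ , x∈I)
    ...   | no  x∉I = no λ { (y , y∈ , y∈I) → x∉I (subst (_∈ value I) (At-injective y∈ x∈) y∈I) }
    closed : ∀ c {p q} → p ≤ q → q < len c → Meets c q → Meets c p
    closed c p≤q q< (y , y∈ , y∈I) with point c (ℕ.≤-<-trans p≤q q<)
    ... | x , x∈ = x , x∈ , ideal-closed I y∈I (chain-⊑ x∈ y∈ p≤q)
    height : ∀ c → ∃ λ k → k ≤ len c × (∀ {p} → p < len c → Meets c p ⇔ p < k)
    height c = initial-segment (len c) (meets? c) (closed c)
    h : Chain → ℕ
    h c = proj₁ (height c)
    bound : ∀ c → h c ≤ len c
    bound c = proj₁ (proj₂ (height c))
    s : State
    s = st (h l) (h m) (h r)
    is-h : ∀ {x c p} → At x c p → x ∈ value I ⇔ p < h c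
    is-h {x} {c} x∈@(at _ p<) = mk⇔ (λ x∈I → Equivalence.to (proj₂ (proj₂ (height c)) p<) (x , x∈ , x∈I))
      λ p<h → found (Equivalence.from (proj₂ (proj₂ (height c)) p<) p<h)
      where
      found : Meets c _ → x ∈ value I
      found (y , y∈ , y∈I) = subst (_∈ value I) (At-injective y∈ x∈) y∈I
    by-chain : ∀ {x c p} → At x c p → x ∈ value I ⇔ p < s ! c
    by-chain {c = l} = is-h
    by-chain {c = m} = is-h
    by-chain {c = r} = is-h
    along : ∀ {c p c′ q} → Cover c p c′ q → p < len c → q < len c′ → q < h c′ → p < h c
    along {c} {c′ = c′} cov p< q< q<h = connect (point c p<) (point c′ q<)
      where
      connect : (∃ λ x → At x c _) → (∃ λ y → At y c′ _) → _ < h c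
      connect (x , x∈) (y , y∈) = Equivalence.to (is-h x∈)
        (ideal-closed I (Equivalence.from (is-h y∈) q<h) (cover⁺ cov x∈ y∈ ◅ ε))
    lo⇒mid : h l ≡ a → 0 < h m
    lo⇒mid eq = along ml (s≤s z≤n) ℕ.≤-refl (ℕ.≤-reflexive (sym eq))
    mid⇒hi : h m ≡ suc a → 0 < h r
    mid⇒hi eq = along rm (s≤s z≤n) ℕ.≤-refl (ℕ.≤-reflexive (sym eq))

  cover-closed : ∀ {s c p c′ q} → Legal s → Cover c p c′ q → q < s ! c′ → p < s ! c
  cover-closed L up q< = ℕ.<-trans (ℕ.n<1+n _) q<
  cover-closed L ml q< = Legal.lo⇒mid L (ℕ.≤-antisym (Legal.lo≤ L) q<)
  cover-closed L rm q< = Legal.mid⇒hi L (ℕ.≤-antisym (Legal.mid≤ L) q<)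

  ⊑-closed : ∀ {s x y c p c′ q} → Legal s → x ⊑ y → At x c p → At y c′ q → q < s ! c′ → p < s ! c
  ⊑-closed L ε x∈ y∈ q< with At-functional x∈ y∈
  ... | refl , refl = q<
  ⊑-closed L (_◅_ {j = z} x⋖z z⊑y) x∈ y∈ q< with locate z
  ... | _ , _ , z∈ = cover-closed L (cover⁻ x⋖z x∈ z∈) (⊑-closed L z⊑y z∈ y∈ q<)

  Below : State → Fin n → Set
  Below s x = proj₁ (proj₂ (locate x)) < s ! proj₁ (locate x)

  below? : ∀ s → Unary.Decidable (Below s)
  below? s x = _ ℕ.<? _

  down-is : ∀ s → Is ⟦ below? s ⟧ s
  down-is s = is go
    where
    go : ∀ {x c p} → At x c p → x ∈ ⟦ below? s ⟧ ⇔ p < s ! c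
    go {x} x∈ with At-functional x∈ (proj₂ (proj₂ (locate x)))
    ... | refl , refl = mk⇔ (∈⟦⟧⁻ (below? s)) (∈⟦⟧⁺ (below? s))

  down : ∀ {s} → Legal s → Ideal
  down {s} L = ⟦ below? s ⟧ , [ closed ]
    where
    closed : IsIdeal ⟦ below? s ⟧
    closed x y y∈ x⊑y with locate x | locate y
    ... | _ , _ , atx | _ , _ , aty = Equivalence.from (∈⇔ (down-is s) atx)
      (⊑-closed L x⊑y atx aty (Equivalence.to (∈⇔ (down-is s) aty) y∈))

  -- The lowest missing point of the chain is not held back by a missing point of the next chain;
  -- this can happen only at x_a and x_{2a+1}.
  Free : State → Chain → Set
  Free s l = lo s ≡ b → 0 < mid s
  Free s m = mid s ≡ a → 0 < hi s
  Free s r = ⊤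

  Rise : State → Chain → Set
  Rise s c = s ! c < len c × Free s c

  module _ (I : Ideal) {s : State} (I-s : Is (value I) s) where

    private
      S = ∁ (value I)

    ∉⇔ : ∀ {x c p} → At x c p → x ∈ S ⇔ s ! c ≤ p
    ∉⇔ x∈ = mk⇔ (λ x∈S → ℕ.≮⇒≥ (x∈∁p⇒x∉p x∈S ∘ Equivalence.from (∈⇔ I-s x∈)))
                (λ ≤p → x∉p⇒x∈∁p (λ x∈I → ℕ.<⇒≱ (Equivalence.to (∈⇔ I-s x∈) x∈I) ≤p))

    -- A missing point strictly below x would lie below a lower cover of x, and all lower covers of
    -- x belong to the ideal.
    minimal⁺ : ∀ {x c} → At x c (s ! c) → Free s c → IsMinimalIn S x
    minimal⁺ {x} {c} x∈ free = Equivalence.from (∉⇔ x∈) ℕ.≤-refl , least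
      where
      covered : ∀ {z c p c′} → Cover c p c′ (s ! c′) → Free s c′ → At z c p → p < s ! c
      covered {c = c} cov free _ = go cov refl free
        where
        go : ∀ {c p c′ q} → Cover c p c′ q → q ≡ s ! c′ → Free s c′ → p < s ! c
        go up eq _    = ℕ.≤-reflexive eq
        go ml eq free = free (sym eq)
        go rm eq free = free (sym eq)
      least : ∀ y → y ∈ S → y ⊑ x → y ≡ x
      least y y∈S y⊑x with star-last y⊑x
      ... | inj₁ y≡x = y≡x
      ... | inj₂ (z , y⊑z , z⋖x) with locate z
      ...   | _ , _ , z∈ = contradiction
        (ideal-closed I (Equivalence.from (∈⇔ I-s z∈) (covered (cover⁻ z⋖x z∈ x∈) free z∈)) y⊑z)
        (x∈∁p⇒x∉p y∈S)

    -- Minimality puts every lower cover of x into the ideal. The cover on the same chain fixes the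
    -- height, the one on the next chain gives `Free`.
    minimal⁻ : ∀ {x c p} → At x c p → IsMinimalIn S x → p ≡ s ! c × Free s c
    minimal⁻ {x} {c} {p} x∈@(at _ p<) (x∈S , least) =
      ℕ.≤-antisym (tight p refl) (Equivalence.to (∉⇔ x∈) x∈S) , free c refl
      where
      not-above : ∀ {c′ q} → Cover c′ q c p → q < len c′ → q < s ! c′
      not-above {c′} {q} cov q< with q ℕ.<? s ! c′ | point c′ q<
      ... | yes q<s | _ = q<s
      ... | no  q≮s | y , y∈ with least y (Equivalence.from (∉⇔ y∈) (ℕ.≮⇒≥ q≮s)) (cover⁺ cov y∈ x∈ ◅ ε)
      ...   | refl with At-functional y∈ x∈
      ...     | refl , refl = contradiction cov irreflexive
        where
        irreflexive : ∀ {c p} → ¬ Cover c p c p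
        irreflexive ()
      tight : ∀ q → q ≡ p → p ≤ s ! c
      tight zero    refl = z≤n
      tight (suc q) refl = not-above up (ℕ.<-trans (ℕ.n<1+n q) p<)
      free : ∀ c′ → c′ ≡ c → Free s c
      free l refl eq with ℕ.≤-antisym (tight p refl) (Equivalence.to (∉⇔ x∈) x∈S)
      ... | refl = subst (λ p → ∀ {c′ q} → Cover c′ q l p → q < len c′ → q < s ! c′) eq not-above ml (s≤s z≤n)
      free m refl eq with ℕ.≤-antisym (tight p refl) (Equivalence.to (∉⇔ x∈) x∈S)
      ... | refl = subst (λ p → ∀ {c′ q} → Cover c′ q m p → q < len c′ → q < s ! c′) eq not-above rm (s≤s z≤n)
      free r refl = tt

-- Steps on triples compute rowmotion, and the complement acts by `comp`.

module Transition {a₀ b : ℕ} (a₀≡ : a₀ ≡ suc b) where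

  open Coordinates a₀≡
  open Fence a₀
  open OrbitStatistics isDecPartialOrder
  open Dynamics b hiding (a)
  open Simulation a₀≡

  -- One description of a step for all three chains. The index is the number of generators on the
  -- chain; `pushed` names the chain whose new generator covers the bottom point of `c`.
  data Outcome (s t : State) (c : Chain) : ℕ → Set where
    rises  : Rise s c → t ! c ≡ suc (s ! c) → Outcome s t c 1
    falls  : ¬ Rise s c → t ! c ≡ 0 → Outcome s t c 0
    pushed : ∀ {c′} → ¬ Rise s c → t ! c ≡ 1 → Cover c 0 c′ (s ! c′) → Rise s c′ → Outcome s t c 0

  outcomeI : ∀ {i j k i′ j′ k′ u} → StepI j i i′ u → Outcome (st i j k) (st i′ j′ k′) l u
  outcomeI (rise i< free) = rises (i< , free) refl
  outcomeI (skip refl)    = falls (λ { (_ , free) → contradiction (free refl) λ () }) refl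
  outcomeI fall           = falls (λ { (i< , _) → ℕ.n≮n _ i< }) refl

  outcomeJ : ∀ {i j k i′ j′ k′ u v} → StepI j i i′ u → StepJ k i′ j j′ v →
             Outcome (st i j k) (st i′ j′ k′) m v
  outcomeJ I (rise j≤ free)  = rises (s≤s j≤ , free) refl
  outcomeJ I (drop stuck _)  = falls (λ { (s≤s j≤ , free) → ¬rise-stuck j≤ free stuck }) refl
  outcomeJ (rise i< free) (push stuck refl) =
    pushed (λ { (s≤s j≤ , free) → ¬rise-stuck j≤ free stuck }) refl ml (i< , free)

  outcomeK : ∀ {i j k i′ j′ k′ u v w} → StepI j i i′ u → StepJ k i′ j j′ v → StepK j′ k k′ w →
             Outcome (st i j k) (st i′ j′ k′) r w
  outcomeK I J (rise k<)                  = rises (k< , tt) refl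
  outcomeK I J (fall _)                   = falls (λ { (k< , _) → ℕ.n≮n _ k< }) refl
  outcomeK I (rise j≤ free) (push refl)   = pushed (λ { (k< , _) → ℕ.n≮n _ k< }) refl rm (s≤s j≤ , free)
  outcomeK I (drop _ _)     (push ())
  outcomeK I (push _ _)     (push ())

  outcome : ∀ {s w t} → Step s w t → ∀ c → ∃ (Outcome s t c)
  outcome (step I J K) l = _ , outcomeI I
  outcome (step I J K) m = _ , outcomeJ I J
  outcome (step I J K) r = _ , outcomeK I J K

  rise-to : ∀ {s t c w} → Rise s c → Outcome s t c w → s ! c < t ! c
  rise-to R (rises _ eq)        = ℕ.≤-reflexive (sym eq)
  rise-to R (falls ¬R _)        = contradiction R ¬R
  rise-to R (pushed ¬R _ _ _)   = contradiction R ¬R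

  module _ (I : Ideal) {s w t} (I-s : Is (value I) s) (S : Step s w t) where

    private
      M = value (minimals (∁ (value I)))

    minimal∈ : ∀ {x c} → At x c (s ! c) → Free s c → x ∈ M
    minimal∈ x∈ free = ∈⟦⟧⁺ (isMinimalIn? (∁ (value I))) (minimal⁺ I I-s x∈ free)

    ∈minimal : ∀ {x c p} → At x c p → x ∈ M → p ≡ s ! c × Free s c
    ∈minimal x∈ x∈M = minimal⁻ I I-s x∈ (∈⟦⟧⁻ (isMinimalIn? (∁ (value I))) x∈M)

    minimal-rise : ∀ {x c p} → At x c p → x ∈ M → Rise s c
    minimal-rise {c = c} x∈@(at _ p<) x∈M =
      subst (_< len c) (proj₁ (∈minimal x∈ x∈M)) p< , proj₂ (∈minimal x∈ x∈M)

    below-minimal : ∀ {x c p w} → At x c p → Outcome s t c w → p < t ! c → ∃ λ y → y ∈ M × x ⊑ y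
    below-minimal {x} {c} {p} x∈ (rises (s< , free) eq) p<t = go (point c s<)
      where
      go : (∃ λ y → At y c (s ! c)) → ∃ λ y → y ∈ M × x ⊑ y
      go (y , y∈) = y , minimal∈ y∈ free , chain-⊑ x∈ y∈ (ℕ.≤-pred (subst (p <_) eq p<t))
    below-minimal x∈ (falls _ eq) p<t = contradiction (subst (_ <_) eq p<t) λ ()
    below-minimal {x} {c} {p} x∈ (pushed {c′} _ eq cov (s< , free)) p<t = go (point c′ s<)
      where
      p≡0 : p ≡ 0
      p≡0 = ℕ.n<1⇒n≡0 (subst (p <_) eq p<t)
      go : (∃ λ y → At y c′ (s ! c′)) → ∃ λ y → y ∈ M × x ⊑ y
      go (y , y∈) = y , minimal∈ y∈ free , cover⁺ cov (subst (At x c) p≡0 x∈) y∈ ◅ ε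

    -- Each point counted by `t` has a generator above it. Conversely `t` counts all generators and,
    -- being legal, everything below them.
    ρ̂-is : Is (value (ρ̂ I)) t
    ρ̂-is = is λ x∈ → mk⇔ (to x∈) (from x∈)
      where
      from : ∀ {x c p} → At x c p → p < t ! c → x ∈ value (ρ̂ I)
      from {c = c} x∈ p<t = ∈⟦⟧⁺ (isBelow? M) (below-minimal x∈ (proj₂ (outcome S c)) p<t)
      through : ∀ {x c p} → At x c p → (∃ λ y → y ∈ M × x ⊑ y) → p < t ! c
      through {c = c} {p} x∈ (y , y∈M , x⊑y) = via (locate y)
        where
        via : (∃₂ λ c′ q → At y c′ q) → p < t ! c
        via (c′ , q , y∈) = ⊑-closed (step-legal S) x⊑y x∈ y∈
          (subst (_< t ! c′) (sym (proj₁ (∈minimal y∈ y∈M)))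
            (rise-to (minimal-rise y∈ y∈M) (proj₂ (outcome S c′))))
      to : ∀ {x c p} → At x c p → x ∈ value (ρ̂ I) → p < t ! c
      to x∈ x∈ρ̂ = through x∈ (∈⟦⟧⁻ (isBelow? M) x∈ρ̂)

    Minimals : Chain → ℕ → Set
    Minimals c u = ∃ λ xs → length xs ≡ u × Unique xs ×
                   (∀ {x} → x List.∈ xs → x ∈ M × ∃ (At x c)) ×
                   (∀ {x p} → At x c p → x ∈ M → x List.∈ xs)

    minimals-of : ∀ {c u} → Outcome s t c u → Minimals c u
    minimals-of {c} (rises (s< , free) _) = go (point c s<)
      where
      go : (∃ λ y → At y c (s ! c)) → Minimals c 1
      go (y , y∈) = y ∷ [] , refl , [] ∷ [] ,
        (λ { (here refl) → minimal∈ y∈ free , _ , y∈ }) ,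
        (λ x∈ x∈M → here (At-injective (subst (At _ c) (proj₁ (∈minimal x∈ x∈M)) x∈) y∈))
    minimals-of (falls ¬R _)      = [] , refl , [] , (λ ()) ,
      λ x∈ x∈M → contradiction (minimal-rise x∈ x∈M) ¬R
    minimals-of (pushed ¬R _ _ _) = [] , refl , [] , (λ ()) ,
      λ x∈ x∈M → contradiction (minimal-rise x∈ x∈M) ¬R

    chains-apart : ∀ {x c c′} → c ≢ c′ → ∃ (At x c) → ¬ ∃ (At x c′)
    chains-apart c≢c′ (_ , x∈) (_ , x∈′) = c≢c′ (proj₁ (At-functional x∈ x∈′))
    combine : ∀ {u v w} → Minimals l u → Minimals m v → Minimals r w → ∣ M ∣ ≡ u + (v + w)
    combine (xs , refl , xs! , xs⁻ , xs⁺) (ys , refl , ys! , ys⁻ , ys⁺) (zs , refl , zs! , zs⁻ , zs⁺) =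
      trans (∣∣≡length unique (λ {x} → mk⇔ (into (locate x)) outof))
        (trans (length-++ xs) (cong (length xs +_) (length-++ ys)))
      where
      unique : Unique (xs ++ (ys ++ zs))
      unique = Unique.++⁺ xs!
        (Unique.++⁺ ys! zs! (λ { (y∈ , z∈) → chains-apart (λ ()) (proj₂ (ys⁻ y∈)) (proj₂ (zs⁻ z∈)) }))
        (λ { (x∈ , yz∈) → apart x∈ (∈-++⁻ ys yz∈) })
        where
        apart : ∀ {x} → x List.∈ xs → ¬ (x List.∈ ys ⊎ x List.∈ zs)
        apart x∈ (inj₁ y∈) = chains-apart (λ ()) (proj₂ (xs⁻ x∈)) (proj₂ (ys⁻ y∈))
        apart x∈ (inj₂ z∈) = chains-apart (λ ()) (proj₂ (xs⁻ x∈)) (proj₂ (zs⁻ z∈))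
      into : ∀ {x} → (∃₂ λ c p → At x c p) → x ∈ M → x List.∈ xs ++ (ys ++ zs)
      into (l , _ , x∈) x∈M = ∈-++⁺ˡ (xs⁺ x∈ x∈M)
      into (m , _ , x∈) x∈M = ∈-++⁺ʳ xs (∈-++⁺ˡ (ys⁺ x∈ x∈M))
      into (r , _ , x∈) x∈M = ∈-++⁺ʳ xs (∈-++⁺ʳ ys (zs⁺ x∈ x∈M))
      outof : ∀ {x} → x List.∈ xs ++ (ys ++ zs) → x ∈ M
      outof x∈ = split (∈-++⁻ xs x∈)
        where
        split : ∀ {x} → x List.∈ xs ⊎ x List.∈ ys ++ zs → x ∈ M
        split (inj₁ x∈) = proj₁ (xs⁻ x∈)
        split (inj₂ x∈) = split′ (∈-++⁻ ys x∈)
          where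
          split′ : ∀ {x} → x List.∈ ys ⊎ x List.∈ zs → x ∈ M
          split′ (inj₁ x∈) = proj₁ (ys⁻ x∈)
          split′ (inj₂ x∈) = proj₁ (zs⁻ x∈)

  size-minimals : ∀ (I : Ideal) {s w t} → Is (value I) s → Step s w t → size (minimals (∁ (value I))) ≡ w
  size-minimals I I-s S@(step J K L) = combine I I-s S
    (minimals-of I I-s S (outcomeI J)) (minimals-of I I-s S (outcomeJ J K))
    (minimals-of I I-s S (outcomeK J K L))

  record _has_ (A : Antichain) (s : State) : Set where
    constructor generates
    field ideal-is : Is (value ⟨ A ⟩) s
  open _has_ public

  ρ-has : ∀ {A s w t} → A has s → Step s w t → ρ A has t
  ρ-has {A} A-s S = generates (ρ̂-is ⟨ A ⟩ (ideal-is A-s) S)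

  size-ρ : ∀ {A s w t} → A has s → Step s w t → size (ρ A) ≡ w
  size-ρ {A} A-s S = size-minimals ⟨ A ⟩ (ideal-is A-s) S

  has-state : ∀ A → ∃ λ s → Legal s × A has s
  has-state A = go (ideal-state ⟨ A ⟩)
    where
    go : (∃ λ s → Legal s × Is (value ⟨ A ⟩) s) → ∃ λ s → Legal s × A has s
    go (s , L , is-s) = s , L , generates is-s

  has-injective : ∀ {A B s} → A has s → B has s → A ≡ B
  has-injective A-s B-s = ⟨⟩-injective (is-unique (ideal-is A-s) (ideal-is B-s))

  has-functional : ∀ {A s t} → A has s → A has t → Legal s → Legal t → s ≡ t
  has-functional A-s A-t = is-functional (ideal-is A-s) (ideal-is A-t)

  -- Rather than collecting the maximal elements of the ideal of `t`, rowmotion is applied to the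
  -- ideal of a predecessor of `t`, whose minimal missing points generate it.
  realise : ∀ {t} → Legal t → ∃ (_has t)
  realise {t} L = go (step-surjective L)
    where
    go : (∃₂ λ s w → Legal s × Step s w t) → ∃ (_has t)
    go (s , w , L′ , S) = minimals (∁ (value (down L′))) , generates (ρ̂-is (down L′) (down-is s) S)

  ρ-injective : ∀ {A B} → ρ A ≡ ρ B → A ≡ B
  ρ-injective {A} {B} eq = go (has-state A) (has-state B)
    where
    go : (∃ λ s → Legal s × A has s) → (∃ λ s → Legal s × B has s) → A ≡ B
    go (s , L , A-s) (t , L′ , B-t) = compare (step-total L) (step-total L′)
      where
      compare : (∃₂ λ w u → Step s w u) → (∃₂ λ w u → Step t w u) → A ≡ B
      compare (_ , u , S) (_ , v , T) = has-injective A-s (subst (B has_) (sym s≡t) B-t)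
        where
        v≡u : v ≡ u
        v≡u = has-functional (ρ-has B-t T) (subst (_has u) eq (ρ-has A-s S)) (step-legal T) (step-legal S)
        s≡t : s ≡ t
        s≡t = step-injective L L′ S (subst (Step t _) v≡u T)

  generator : (I : Ideal) → ∃ λ A → ⟨ A ⟩ ≡ I
  generator I = go (ideal-state I)
    where
    go : (∃ λ s → Legal s × Is (value I) s) → ∃ λ A → ⟨ A ⟩ ≡ I
    go (s , L , I-s) = proj₁ (realise L) , Refinement.value-injective
      (⊆-antisym (Equivalence.to (is-unique A-s I-s)) (Equivalence.from (is-unique A-s I-s)))
      where A-s = ideal-is (proj₂ (realise L))

  flip : Chain → Chain
  flip l = r
  flip m = m
  flip r = l

  -- The order reversal swaps the outer chains and turns each chain upside down.
  κ-at : ∀ {x c p} → At x c p → At (κ x) (flip c) (len c ∸ suc p)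
  κ-at {x} {c} {p} (at eq p<) = at
    (trans (Fin.opposite-prop x) (trans (cong (λ t → n ∸ suc t) eq)
      (trans (cong (_∸ suc (off c + p)) (sym total)) (ℕ.m+n∸n≡m _ (suc (off c + p))))))
    (shorter c p<)
    where
    shorter : ∀ c {p} → p < len c → len c ∸ suc p < len (flip c)
    shorter l {p} (s≤s _) = s≤s (ℕ.m∸n≤m b p)
    shorter m {p} (s≤s _) = s≤s (ℕ.m∸n≤m a p)
    shorter r {p} (s≤s _) = s≤s (ℕ.m∸n≤m b p)
    partition : ∀ c → off (flip c) + (len c + off c) ≡ n
    partition l = trans (lemma a) (sym n≡)
      where
      lemma : ∀ a → a + suc a + (a + 0) ≡ a + suc a + a
      lemma = solve-∀
    partition m = trans (lemma a) (sym n≡)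
      where
      lemma : ∀ a → a + (suc a + a) ≡ a + suc a + a
      lemma = solve-∀
    partition r = trans (lemma a) (sym n≡)
      where
      lemma : ∀ a → a + (a + suc a) ≡ a + suc a + a
      lemma = solve-∀
    total : off (flip c) + (len c ∸ suc p) + suc (off c + p) ≡ n
    total = trans (lemma (off (flip c)) (len c ∸ suc p) (off c) p)
      (trans (cong (λ t → off (flip c) + (t + off c)) (ℕ.m∸n+n≡m p<)) (partition c))
      where
      lemma : ∀ f q o p → f + q + suc (o + p) ≡ f + ((q + suc p) + o)
      lemma = solve-∀

  comp-! : ∀ s c → comp s ! c ≡ len c ∸ s ! flip c
  comp-! s l = refl
  comp-! s m = refl
  comp-! s r = refl

  complement-is : ∀ (I : Ideal) {s} → Legal s → Is (value I) s → Is (value (complement I)) (comp s)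
  complement-is I {s} L I-s = is flipped
    where
    flipped : ∀ {x c p} → At x c p → x ∈ value (complement I) ⇔ p < comp s ! c
    flipped {x} {c} {p} x∈@(at _ p<) = mk⇔ to from
      where
      k≤ : s ! flip c ≤ len c
      k≤ = bound c
        where
        bound : ∀ c → s ! flip c ≤ len c
        bound l = Legal.hi≤ L
        bound m = Legal.mid≤ L
        bound r = Legal.lo≤ L
      to : x ∈ value (complement I) → p < comp s ! c
      to x∈C = go (∈⟦⟧⁻ (isImageOutside? (value I)) x∈C)
        where
        go : IsImageOutside (value I) x → p < comp s ! c
        go (y , y∉I , κy≡x) = subst (p <_) (sym (comp-! s c)) (ℕ.m+n≤o⇒m≤o∸n (suc p)
          (ℕ.≤-trans (ℕ.≤-reflexive (ℕ.+-comm (suc p) _)) (ℕ.m≤o∸n⇒m+n≤o _ p< (ℕ.≮⇒≥ κx≮))))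
          where
          κx≡y : κ x ≡ y
          κx≡y = trans (cong κ (sym κy≡x)) (Fin.opposite-involutive y)
          κx≮ : ¬ len c ∸ suc p < s ! flip c
          κx≮ lt = y∉I (subst (_∈ value I) κx≡y (Equivalence.from (∈⇔ I-s (κ-at x∈)) lt))
      from : p < comp s ! c → x ∈ value (complement I)
      from p<k = ∈⟦⟧⁺ (isImageOutside? (value I)) (κ x , κx∉I , Fin.opposite-involutive x)
        where
        κx∉I : κ x ∉ value I
        κx∉I κx∈ = ℕ.<⇒≱ (Equivalence.to (∈⇔ I-s (κ-at x∈)) κx∈) (ℕ.m+n≤o⇒m≤o∸n _
          (ℕ.≤-trans (ℕ.≤-reflexive (ℕ.+-comm _ (suc p)))
            (ℕ.m≤o∸n⇒m+n≤o _ k≤ (subst (p <_) (comp-! s c) p<k))))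

  ideal-≡ : ∀ (I J : Ideal) {s} → Is (value I) s → Is (value J) s → I ≡ J
  ideal-≡ I J I-s J-s = Refinement.value-injective
    (⊆-antisym (Equivalence.to (is-unique I-s J-s)) (Equivalence.from (is-unique I-s J-s)))

  complement-involutive : ∀ I → complement (complement I) ≡ I
  complement-involutive I = go (ideal-state I)
    where
    go : (∃ λ s → Legal s × Is (value I) s) → complement (complement I) ≡ I
    go (s , L , I-s) = ideal-≡ (complement (complement I)) I
      (complement-is (complement I) (comp-legal L) (complement-is I L I-s))
      (subst (Is (value I)) (sym (comp-involutive L)) I-s)

  -- Conjugation of rowmotion to its inverse, phrased without the inverse map.
  ρ̂-complement-ρ̂ : ∀ I → ρ̂ (complement (ρ̂ I)) ≡ complement I
  ρ̂-complement-ρ̂ I = go (ideal-state I)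
    where
    go : (∃ λ s → Legal s × Is (value I) s) → ρ̂ (complement (ρ̂ I)) ≡ complement I
    go (s , L , I-s) = go′ (step-total L)
      where
      go′ : (∃₂ λ w t → Step s w t) → ρ̂ (complement (ρ̂ I)) ≡ complement I
      go′ (w , t , S) = ideal-≡ (ρ̂ (complement (ρ̂ I))) (complement I)
        (ρ̂-is (complement (ρ̂ I)) C-t (proj₂ (step-comp L S))) (complement-is I L I-s)
        where
        C-t : Is (value (complement (ρ̂ I))) (comp t)
        C-t = complement-is (ρ̂ I) (step-legal S) (ρ̂-is I I-s S)

  complement-⟨⟩ : ∀ {A B s} → Legal s → A has s → B has comp s → complement ⟨ A ⟩ ≡ ⟨ B ⟩
  complement-⟨⟩ {A} {B} L A-s B-s̅ =
    ideal-≡ (complement ⟨ A ⟩) ⟨ B ⟩ (complement-is ⟨ A ⟩ L (ideal-is A-s)) (ideal-is B-s̅)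

-- Cyclic counters that record their rises.

data CycStep (N : ℕ) : ℕ → ℕ → ℕ → Set where
  rise : ∀ {x} → x < N → CycStep N x (suc x) 1
  fall : CycStep N N 0 0

-- Cyc N x t y u: t iterations of the successor modulo 1 + N lead from x to y, and u of them rise.
data Cyc (N : ℕ) : ℕ → ℕ → ℕ → ℕ → Set where
  []  : ∀ {x} → Cyc N x 0 x 0
  _∷_ : ∀ {x y z t u v} → CycStep N x y u → Cyc N y t z v → Cyc N x (suc t) z (u + v)

infixr 5 _∷_

module _ {N : ℕ} where

  _◅◅ᶜ_ : ∀ {x y z t₁ t₂ u v} → Cyc N x t₁ y u → Cyc N y t₂ z v → Cyc N x (t₁ + t₂) z (u + v)
  []       ◅◅ᶜ q = q
  _∷_ {u = u} {v} s p ◅◅ᶜ q = subst (Cyc N _ _ _) (sym (ℕ.+-assoc u v _)) (s ∷ (p ◅◅ᶜ q))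

  up : ∀ x t → t + x ≤ N → Cyc N x t (t + x) t
  up x zero    _ = []
  up x (suc t) p = rise (ℕ.≤-trans (s≤s (ℕ.m≤n+m x t)) p)
    ∷ subst (λ y → Cyc N (suc x) t y t) (ℕ.+-suc t x)
        (up (suc x) t (ℕ.≤-trans (ℕ.≤-reflexive (ℕ.+-suc t x)) p))

  around : ∀ t x y → t + x ≡ N → y ≤ N → Cyc N x (t + suc y) y (t + y)
  around t x y refl y≤ = up x t ℕ.≤-refl ◅◅ᶜ (fall ∷
    subst (λ z → Cyc N 0 y z y) (ℕ.+-identityʳ y)
      (up 0 y (ℕ.≤-trans (ℕ.≤-reflexive (ℕ.+-identityʳ y)) y≤)))

  full-turn : ∀ {x} → x ≤ N → Cyc N x (suc N) x N
  full-turn {x} x≤ = subst₂ (λ t u → Cyc N x t x u)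
    (trans (ℕ.+-suc (N ∸ x) x) (cong suc (ℕ.m∸n+n≡m x≤))) (ℕ.m∸n+n≡m x≤)
    (around (N ∸ x) x x (ℕ.m∸n+n≡m x≤) x≤)

-- In a large orbit, the third chain never contributes exactly one element when the second one is empty;
-- kap enumerates the other possibilities.
kap : ℕ → ℕ
kap zero    = 0
kap (suc t) = 2 + t

kap≢1 : ∀ {q} → kap q ≢ 1
kap≢1 {zero}  ()
kap≢1 {suc q} ()

orbit-size orbit-weight : ℕ → Class → ℕ
orbit-size a small  = a + 1
orbit-size a medium = 3 * a + 2
orbit-size a large  = a ^ 2 + 2 * a
orbit-weight a small  = 3 * a
orbit-weight a medium = 9 * a ∸ 3
orbit-weight a large  = 3 * a ^ 2 + 3 * a ∸ 2

-- Orbits followed from the section until their return, on triples.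

module Orbits (d : ℕ) where

  b = suc d

  open Dynamics b

  -- A transversal of the orbits.
  data Section : State → Class → Set where
    low    : ∀ {c} → c < b → Section (st c 0 1) small
    high   : ∀ {t} → t < b → Section (st b (suc a) (2 + t)) small
    centre : Section (st b 0 1) medium
    turn   : ∀ {q k} → q ≤ b → k ≡ kap q → Section (st b 0 k) large

  section-class : ∀ {s c c′} → Section s c → Section s c′ → c ≡ c′
  section-class (low _)        (low _)        = refl
  section-class (low p)        centre         = contradiction p (ℕ.n≮n _)
  section-class (low p)        (turn _ _)     = contradiction p (ℕ.n≮n _)
  section-class (high _)       (high _)       = refl
  section-class centre         (low p)        = contradiction p (ℕ.n≮n _)
  section-class centre         centre         = refl
  section-class centre         (turn {q} _ e) = contradiction (sym e) (kap≢1 {q})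
  section-class (turn _ _)     (low p)        = contradiction p (ℕ.n≮n _)
  section-class (turn {q} _ e) centre         = contradiction (sym e) (kap≢1 {q})
  section-class (turn _ _)     (turn _ _)     = refl

  section-legal : ∀ {s c} → Section s c → Legal s
  section-legal (low p) = legal (ℕ.≤-trans (ℕ.<⇒≤ p) (ℕ.n≤1+n b)) z≤n (s≤s z≤n)
    (λ { refl → contradiction p (ℕ.<⇒≯ ℕ.≤-refl) }) (λ ())
  section-legal (high p) = legal (ℕ.n≤1+n b) ℕ.≤-refl (s≤s p) (λ _ → s≤s z≤n) (λ _ → s≤s z≤n)
  section-legal centre = legal (ℕ.n≤1+n b) z≤n (s≤s z≤n) (λ eq → contradiction (sym eq) ℕ.1+n≢n) (λ ())
  section-legal (turn {zero} _ refl) =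
    legal (ℕ.n≤1+n b) z≤n z≤n (λ eq → contradiction (sym eq) ℕ.1+n≢n) (λ ())
  section-legal (turn {suc q} q≤ refl) =
    legal (ℕ.n≤1+n b) z≤n (s≤s q≤) (λ eq → contradiction (sym eq) ℕ.1+n≢n) (λ ())

  Off : State → Set
  Off s = ∀ {c} → ¬ Section s c

  -- On the section the second chain is either empty or full.
  off-mid : ∀ {i j k} → j ≤ b → Off (st i (suc j) k)
  off-mid j≤ (high _) = ℕ.n≮n _ j≤

  -- Arrive s t w s′: s′ is reached from s in t ≥ 1 steps of total weight w,
  -- with no point of the section strictly in between.
  data Arrive : State → ℕ → ℕ → State → Set where
    [_]   : ∀ {s w t} → Step s w t → Arrive s 1 w t
    _∷⟨_⟩_ : ∀ {s w t L W u} → Step s w t → Off t → Arrive t L W u → Arrive s (suc L) (w + W) u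

  infixr 5 _∷⟨_⟩_ _++⟨_⟩_

  cast : ∀ {s t L L′ W W′} → L ≡ L′ → W ≡ W′ → Arrive s L W t → Arrive s L′ W′ t
  cast refl refl p = p

  _++⟨_⟩_ : ∀ {s t u L₁ L₂ W₁ W₂} → Arrive s L₁ W₁ t → Off t → Arrive t L₂ W₂ u →
           Arrive s (L₁ + L₂) (W₁ + W₂) u
  [ S ] ++⟨ o ⟩ q = S ∷⟨ o ⟩ q
  _∷⟨_⟩_ {w = w} {W = W} S o p ++⟨ o′ ⟩ q = cast refl (sym (ℕ.+-assoc w W _)) (S ∷⟨ o ⟩ (p ++⟨ o′ ⟩ q))

  cyc-stepI : ∀ {j x y u} → 0 < j → CycStep a x y u → StepI j x y u
  cyc-stepI 0<j (rise x<) = rise x< (λ _ → 0<j)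
  cyc-stepI 0<j fall      = fall

  cyc-stepK : ∀ {j′ x y u} → j′ ≢ suc a → CycStep a x y u → StepK j′ x y u
  cyc-stepK j≢ (rise x<) = rise x<
  cyc-stepK j≢ fall      = fall j≢

  -- As the second chain is nonempty, x_a is not blocked; as it does not become full, the third
  -- chain is not pushed; and below height a its own rise is unconditional.
  climb-step : ∀ {i i′ j k k′ u v} → j < b → CycStep a i i′ u → CycStep a k k′ v →
               Step (st i (suc j) k) (u + (1 + v)) (st i′ (suc (suc j)) k′)
  climb-step j< I K = step (cyc-stepI (s≤s z≤n) I)
    (rise (s≤s (ℕ.<⇒≤ j<)) (λ eq → contradiction (ℕ.suc-injective eq) (ℕ.<⇒≢ j<)))
    (cyc-stepK (λ eq → ℕ.<⇒≢ j< (ℕ.suc-injective (ℕ.suc-injective eq))) K)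

  climbing : ∀ t {i i′ j j′ k k′ u v} → suc t + j ≡ j′ → j′ ≤ b →
             Cyc a i (suc t) i′ u → Cyc a k (suc t) k′ v →
             Arrive (st i (suc j) k) (suc t) (suc t + (u + v)) (st i′ (suc j′) k′)
  climbing zero refl j≤ (_∷_ {u = u} I []) (_∷_ {u = v} K []) = cast refl (lemma u v) [ climb-step j≤ I K ]
    where
    lemma : ∀ u v → u + (1 + v) ≡ 1 + ((u + 0) + (v + 0))
    lemma = solve-∀
  climbing (suc t) {j = j} refl j≤ (_∷_ {u = u} {v = u′} I Is) (_∷_ {u = v} {v = v′} K Ks) =
    cast refl (lemma t u v u′ v′)
      (climb-step j< I K ∷⟨ off-mid j< ⟩ climbing t (ℕ.+-suc (suc t) j) j≤ Is Ks)
    where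
    j< : j < b
    j< = ℕ.≤-trans (s≤s (ℕ.m≤n+m j (suc t))) j≤
    lemma : ∀ t u v u′ v′ → u + (1 + v) + (suc t + (u′ + v′)) ≡ suc (suc t) + ((u + u′) + (v + v′))
    lemma = solve-∀

  -- A climb takes b = a - 1 steps, which is -2 modulo a + 1. Starting from 0 or 1 the counter does
  -- not wrap; from 2 + t it wraps once and ends at t, with one rise fewer.
  lap₀ : Cyc a 0 b b b
  lap₀ = subst (λ y → Cyc a 0 b y b) (ℕ.+-identityʳ b)
    (up 0 b (ℕ.≤-trans (ℕ.≤-reflexive (ℕ.+-identityʳ b)) (ℕ.n≤1+n b)))

  lap₁ : Cyc a 1 b a b
  lap₁ = subst (λ y → Cyc a 1 b y b) (ℕ.+-comm b 1) (up 1 b (ℕ.≤-reflexive (ℕ.+-comm b 1)))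

  lap₂ : ∀ {t} → t < b → Cyc a (2 + t) b t d
  lap₂ {t} (s≤s t≤d) = subst₂ (λ n w → Cyc a (2 + t) n t w)
    (trans (ℕ.+-suc (d ∸ t) t) (cong suc eq)) eq
    (around (d ∸ t) (2 + t) t (trans (ℕ.+-suc _ _) (cong suc (trans (ℕ.+-suc _ _) (cong suc eq))))
      (ℕ.≤-trans t≤d (ℕ.≤-trans (ℕ.n≤1+n d) (ℕ.n≤1+n b))))
    where
    eq : d ∸ t + t ≡ d
    eq = ℕ.m∸n+n≡m t≤d

  lap : ∀ {i i′ k k′ u v} → Cyc a i b i′ u → Cyc a k b k′ v →
        Arrive (st i 1 k) b (b + (u + v)) (st i′ a k′)
  lap I K = climbing d (ℕ.+-identityʳ b) ℕ.≤-refl I K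

  off₁ : ∀ {i k} → Off (st i 1 k)
  off₁ = off-mid z≤n

  offₐ : ∀ {i k} → Off (st i a k)
  offₐ = off-mid ℕ.≤-refl

  round : ∀ {s i i′ k k′ w u v W L t} → Step s w (st i 1 k) → Cyc a i b i′ u → Cyc a k b k′ v →
          Arrive (st i′ a k′) L W t → Arrive s (suc (b + L)) (w + ((b + (u + v)) + W)) t
  round S I K p = S ∷⟨ off₁ ⟩ (lap I K ++⟨ offₐ ⟩ p)

  first : ∀ {i i′ k k′ u w} → StepI 0 i i′ u → StepK 1 k k′ w → Step (st i 0 k) (u + (1 + w)) (st i′ 1 k′)
  first I K = step I (rise z≤n (λ ())) K

  -- The climb ends at height a facing an empty third chain, so the second chain drops without ever
  -- being full: 1 + (a - 1) + 1 steps.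
  low-cycle : ∀ {c} → c < b → Arrive (st c 0 1) (suc a) (3 * a) (st c 0 1)
  low-cycle {zero} _ = cast (cong suc (ℕ.+-comm b 1)) (lemma d)
    (round (first (rise (s≤s z≤n) (λ ())) (rise (s≤s (s≤s z≤n)))) lap₁ (lap₂ (s≤s z≤n))
      [ step fall (drop (inj₁ (refl , refl)) (λ ())) (rise (s≤s z≤n)) ])
    where
    lemma : ∀ d → 3 + ((1 + d + (1 + d + d)) + 1) ≡ 3 * (2 + d)
    lemma = solve-∀
  low-cycle {suc c} c<b = cast (cong suc (ℕ.+-comm b 1)) (lemma d)
    (round (first (rise (ℕ.m<n⇒m<1+n c<b) (λ eq → contradiction eq (ℕ.<⇒≢ c<b))) (rise (s≤s (s≤s z≤n))))
      (lap₂ (ℕ.<-trans (ℕ.n<1+n c) c<b)) (lap₂ (s≤s z≤n))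
      [ step (rise (ℕ.<-trans (ℕ.n<1+n c) (ℕ.m<n⇒m<1+n c<b)) (λ _ → s≤s z≤n))
             (drop (inj₁ (refl , refl)) (ℕ.<⇒≢ (ℕ.m<n⇒m<1+n c<b))) (rise (s≤s z≤n)) ])
    where
    lemma : ∀ d → 3 + ((1 + d + (d + d)) + 2) ≡ 3 * (2 + d)
    lemma = solve-∀

  -- Here the first chain is completed just when the second one is full, so the second chain is
  -- pushed to 1 and is never empty.
  high-cycle : ∀ {t} → t < b → Arrive (st b (suc a) (2 + t)) (suc a) (3 * a) (st b (suc a) (2 + t))
  high-cycle {t} t<b = split (ℕ.m≤n⇒m<n∨m≡n (ℕ.≤-pred t<b))
    where
    lemma₁ : ∀ d → 2 + ((1 + d + (d + d)) + 3) ≡ 3 * (2 + d)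
    lemma₁ = solve-∀
    lemma₂ : ∀ d → 1 + ((1 + d + (d + (1 + d))) + 3) ≡ 3 * (2 + d)
    lemma₂ = solve-∀
    split : t < d ⊎ t ≡ d → Arrive (st b (suc a) (2 + t)) (suc a) (3 * a) (st b (suc a) (2 + t))
    split (inj₁ t<d) = cast (cong suc (ℕ.+-comm b 1)) (lemma₁ d)
      (round (step (rise ℕ.≤-refl (λ _ → s≤s z≤n)) (push (inj₂ refl) refl) (rise (s≤s (s≤s t<d))))
        (lap₂ ℕ.≤-refl) (lap₂ (s≤s t<d))
        [ step (rise (ℕ.n≤1+n b) (λ _ → s≤s z≤n)) (rise ℕ.≤-refl (λ _ → s≤s z≤n)) (rise (s≤s t<b)) ])
    split (inj₂ refl) = cast (cong suc (ℕ.+-comm b 1)) (lemma₂ d)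
      (round (step (rise ℕ.≤-refl (λ _ → s≤s z≤n)) (push (inj₂ refl) refl) (fall λ ()))
        (lap₂ ℕ.≤-refl) lap₀
        [ step (rise (ℕ.n≤1+n b) (λ _ → s≤s z≤n)) (rise ℕ.≤-refl (λ _ → s≤s z≤n)) (rise ℕ.≤-refl) ])

  -- The medium orbit consists of three climbs, taking a, a + 1 and a + 1 steps. The first ends
  -- blocked and is followed by a push, the second ends full and is followed by a push, the third
  -- ends blocked and drops to the start.
  centre-1 : Arrive (st b 0 1) (suc b) (2 + (b + (b + d))) (st b a 0)
  centre-1 = first (skip refl) (rise (s≤s (s≤s z≤n))) ∷⟨ off₁ ⟩ lap lap₀ (lap₂ (s≤s z≤n))

  centre-2 : Arrive (st b a 0) (b + 2) (4 + (b + (d + b))) (st b (suc a) 1)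
  centre-2 = cast (lemma₁ d) (lemma₂ d)
    (round (step (rise ℕ.≤-refl (λ _ → s≤s z≤n)) (push (inj₁ (refl , refl)) refl) (rise (s≤s z≤n)))
      (lap₂ ℕ.≤-refl) lap₁
      [ step (rise (ℕ.n≤1+n b) (λ _ → s≤s z≤n)) (rise ℕ.≤-refl (λ _ → s≤s z≤n)) (push refl) ])
    where
    lemma₁ : ∀ d → suc (suc d + 1) ≡ suc d + 2
    lemma₁ = solve-∀
    lemma₂ : ∀ d → 2 + ((suc d + (d + suc d)) + 2) ≡ 4 + (suc d + (d + suc d))
    lemma₂ = solve-∀

  centre-3 : Arrive (st b (suc a) 1) (b + 2) (4 + (b + (d + d))) (st b 0 1)
  centre-3 = cast (lemma₁ d) (lemma₂ d)
    (round (step (rise ℕ.≤-refl (λ _ → s≤s z≤n)) (push (inj₂ refl) refl) (rise (s≤s (s≤s z≤n))))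
      (lap₂ ℕ.≤-refl) (lap₂ (s≤s z≤n))
      [ step (rise (ℕ.n≤1+n b) (λ _ → s≤s z≤n))
             (drop (inj₁ (refl , refl)) (λ eq → ℕ.1+n≢n (sym eq))) (rise (s≤s z≤n)) ])
    where
    lemma₁ : ∀ d → suc (suc d + 1) ≡ suc d + 2
    lemma₁ = solve-∀
    lemma₂ : ∀ d → 2 + ((suc d + (d + d)) + 2) ≡ 4 + (suc d + (d + d))
    lemma₂ = solve-∀

  off-centre : Off (st b (suc a) 1)
  off-centre ()

  centre-cycle : Arrive (st b 0 1) (3 * a + 2) (9 * d + 15) (st b 0 1)
  centre-cycle = cast (lemma₁ d) (lemma₂ d) (centre-1 ++⟨ offₐ ⟩ (centre-2 ++⟨ off-centre ⟩ centre-3))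
    where
    lemma₁ : ∀ d → 2 + d + (suc d + 2 + (suc d + 2)) ≡ 3 * (2 + d) + 2
    lemma₁ = solve-∀
    lemma₂ : ∀ d → 2 + (suc d + (suc d + d)) +
                   (4 + (suc d + (d + suc d)) + (4 + (suc d + (d + d)))) ≡ 9 * d + 15
    lemma₂ = solve-∀

  -- The first chain while the second one goes from empty to full (with i = h) and back to empty.
  record LowLoop (i h i′ w : ℕ) : Set where
    field
      {i₁ i₂ u₁ u₂ u₃ u₄} : ℕ
      start  : StepI 0 i i₁ u₁
      middle : Cyc a i₁ b i₂ u₂
      fill   : StepI a i₂ h u₃
      empty  : StepI (suc a) h i′ u₄
      h≢b    : h ≢ b
      i′≢a   : i′ ≢ a
      total  : (u₁ + u₂) + (u₃ + u₄) ≡ a + w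

  low-rise : ∀ {i} → i < b → LowLoop i i (suc i) 1
  low-rise {zero} i<b = record
    { start = rise (s≤s z≤n) (λ ()) ; middle = lap₁ ; fill = fall ; empty = rise (s≤s z≤n) (λ ())
    ; h≢b = λ () ; i′≢a = λ () ; total = refl }
  low-rise {suc i} i<b = record
    { start = rise (ℕ.m<n⇒m<1+n i<b) (λ eq → contradiction eq (ℕ.<⇒≢ i<b)) ; middle = lap₂ i<b′
    ; fill = rise (ℕ.m<n⇒m<1+n i<b′) (λ _ → s≤s z≤n)
    ; empty = rise (ℕ.m<n⇒m<1+n i<b) (λ _ → s≤s z≤n)
    ; h≢b = ℕ.<⇒≢ i<b ; i′≢a = ℕ.<⇒≢ (s≤s i<b)
    ; total = lemma d }
    where
    i<b′ = ℕ.<-trans (ℕ.n<1+n i) i<b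
    lemma : ∀ d → (1 + d) + 2 ≡ 2 + d + 1
    lemma = solve-∀

  low-fall : LowLoop b a 0 0
  low-fall = record
    { start = skip refl ; middle = lap₀ ; fill = rise ℕ.≤-refl (λ _ → s≤s z≤n) ; empty = fall
    ; h≢b = ℕ.1+n≢n ; i′≢a = λ () ; total = lemma d }
    where
    lemma : ∀ d → suc d + 1 ≡ 2 + d + 0
    lemma = solve-∀

  -- The third chain has `kap q` elements when the second one is empty and q + 1 when it is full.
  -- The gap in `kap` arises at q = 0: the full second chain pushes the third to 1, which then rises
  -- to 2.
  record HighLoop (q q′ w : ℕ) : Set where
    field
      {k₁ k₂ u₁ u₂ u₃ u₄} : ℕ
      start  : StepK 1 (kap q) k₁ u₁
      middle : Cyc a k₁ b k₂ u₂
      0<k₂   : 0 < k₂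
      fill   : StepK (suc a) k₂ (suc q) u₃
      empty  : StepK 0 (suc q) (kap q′) u₄
      total  : (u₁ + u₂) + (u₃ + u₄) ≡ a + w

  high-loop : ∀ {q q′ w} → CycStep b q q′ w → HighLoop q q′ w
  high-loop {zero} (rise _) = record
    { start = rise (s≤s z≤n) ; middle = lap₁ ; 0<k₂ = s≤s z≤n
    ; fill = push refl ; empty = rise (s≤s (s≤s z≤n))
    ; total = refl }
  high-loop {suc q} (rise q<) = record
    { start = rise (s≤s q<) ; middle = lap₂ q< ; 0<k₂ = s≤s z≤n
    ; fill = rise (ℕ.m<n⇒m<1+n q<) ; empty = rise (s≤s q<)
    ; total = lemma d }
    where
    lemma : ∀ d → (1 + d) + 2 ≡ 2 + d + 1
    lemma = solve-∀
  high-loop fall = record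
    { start = fall (λ ()) ; middle = lap₀ ; 0<k₂ = s≤s z≤n ; fill = rise ℕ.≤-refl ; empty = fall (λ ())
    ; total = lemma d }
    where
    lemma : ∀ d → suc d + 1 ≡ 2 + d + 0
    lemma = solve-∀

  module _ {i h i′ w q q′ w′} (I : LowLoop i h i′ w) (K : HighLoop q q′ w′) where

    private
      module I = LowLoop I
      module K = HighLoop K

    full : State
    full = st h (suc a) (suc q)

    off-full : Off full
    off-full (high _) = I.h≢b refl

    fill-up : Arrive (st i 0 (kap q)) (suc a)
                     ((I.u₁ + (1 + K.u₁)) + ((b + (I.u₂ + K.u₂)) + (I.u₃ + (1 + K.u₃)))) full
    fill-up = cast (cong suc (ℕ.+-comm b 1)) refl
      (round (first I.start K.start) I.middle K.middle
        [ step I.fill (rise ℕ.≤-refl (λ _ → K.0<k₂)) K.fill ])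

    empty-out : Step full (I.u₄ + (0 + K.u₄)) (st i′ 0 (kap q′))
    empty-out = step I.empty (drop (inj₂ refl) I.i′≢a) K.empty

    -- In a + 2 steps the second chain rises a + 1 times, and each outer chain a times plus once
    -- more unless its counter modulo a wraps. Over a loops each counter wraps once, which gives
    -- a(3a + 1) + 2(a - 1) = 3a² + 3a - 2.
    loop : Arrive (st i 0 (kap q)) (a + 2) (3 * a + 1 + (w + w′)) (st i′ 0 (kap q′))
    loop = cast (lemma₁ d)
      (trans (lemma₂ I.u₁ K.u₁ b I.u₂ K.u₂ I.u₃ K.u₃ I.u₄ K.u₄)
        (trans (cong₂ (λ x y → 2 + b + (x + y)) I.total K.total) (lemma₃ d w w′)))
      (fill-up ++⟨ off-full ⟩ [ empty-out ])
      where
      lemma₁ : ∀ d → 3 + d + 1 ≡ 2 + d + 2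
      lemma₁ = solve-∀
      lemma₂ : ∀ u₁ v₁ b u₂ v₂ u₃ v₃ u₄ v₄ →
               (u₁ + (1 + v₁)) + ((b + (u₂ + v₂)) + (u₃ + (1 + v₃))) + (u₄ + (0 + v₄))
               ≡ 2 + b + (((u₁ + u₂) + (u₃ + u₄)) + ((v₁ + v₂) + (v₃ + v₄)))
      lemma₂ = solve-∀
      lemma₃ : ∀ d w w′ → 3 + d + ((2 + d + w) + (2 + d + w′)) ≡ 3 * (2 + d) + 1 + (w + w′)
      lemma₃ = solve-∀

  off-empty : ∀ {i q} → i < b → Off (st i 0 (kap q))
  off-empty {q = q} i<b p = apart i<b refl p
    where
    apart : ∀ {i k c} → i < b → k ≡ kap q → ¬ Section (st i 0 k) c
    apart _   e (low _)    = kap≢1 {q} (sym e)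
    apart i<b _ centre     = ℕ.n≮n _ i<b
    apart i<b _ (turn _ _) = ℕ.n≮n _ i<b

  climb : ∀ t {i q q′ w} → suc t + i ≡ b → Cyc b q (suc t) q′ w →
          Arrive (st i 0 (kap q)) (suc t * (a + 2)) (suc t * (3 * a + 2) + w) (st b 0 (kap q′))
  climb zero refl (_∷_ {u = w} s []) =
    cast (sym (ℕ.+-identityʳ _)) (lemma d w) (loop (low-rise ℕ.≤-refl) (high-loop s))
    where
    lemma : ∀ d w → 3 * (2 + d) + 1 + (1 + w) ≡ 1 * (3 * (2 + d) + 2) + (w + 0)
    lemma = solve-∀
  climb (suc t) {i} eq (_∷_ {y = q} {u = w} {v = w′} s c) =
    cast refl (lemma t d w w′)
      (loop (low-rise (ℕ.<-trans (ℕ.n<1+n i) i<b)) (high-loop s)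
        ++⟨ off-empty {q = q} i<b ⟩ climb t (trans (ℕ.+-suc (suc t) i) eq) c)
    where
    i<b : suc i < b
    i<b = ℕ.≤-trans (s≤s (s≤s (ℕ.m≤n+m i t))) (ℕ.≤-reflexive eq)
    lemma : ∀ t d w w′ → 3 * (2 + d) + 1 + (1 + w) + (suc t * (3 * (2 + d) + 2) + w′)
                       ≡ suc (suc t) * (3 * (2 + d) + 2) + (w + w′)
    lemma = solve-∀

  large-cycle : ∀ {q} → q ≤ b →
    Arrive (st b 0 (kap q)) (a * (a + 2)) (3 * (a * a) + 3 * d + 4) (st b 0 (kap q))
  large-cycle q≤ = go (full-turn q≤)
    where
    go : ∀ {q q′} → Cyc b q a q′ b →
         Arrive (st b 0 (kap q)) (a * (a + 2)) (3 * (a * a) + 3 * d + 4) (st b 0 (kap q′))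
    go c = go′ c refl
      where
      go′ : ∀ {q q′ w} → Cyc b q a q′ w → w ≡ b →
            Arrive (st b 0 (kap q)) (a * (a + 2)) (3 * (a * a) + 3 * d + 4) (st b 0 (kap q′))
      go′ (_∷_ {y = q} {u = w} {v = w′} s c) eq = cast refl
        (trans (lemma₁ d w w′) (trans (cong (weight +_) eq) (lemma₂ d)))
        -- The loop that wraps i from b to 0 comes first; b further loops bring i back to b.
        (loop low-fall (high-loop s) ++⟨ off-empty {q = q} (s≤s z≤n) ⟩ climb d (ℕ.+-identityʳ b) c)
        where
        weight = 3 * (2 + d) + 1 + suc d * (3 * (2 + d) + 2)
        lemma₁ : ∀ d w w′ → 3 * (2 + d) + 1 + (0 + w) + (suc d * (3 * (2 + d) + 2) + w′)
                          ≡ 3 * (2 + d) + 1 + suc d * (3 * (2 + d) + 2) + (w + w′)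
        lemma₁ = solve-∀
        lemma₂ : ∀ d → 3 * (2 + d) + 1 + suc d * (3 * (2 + d) + 2) + suc d
                       ≡ 3 * ((2 + d) * (2 + d)) + 3 * d + 4
        lemma₂ = solve-∀

  section-cycle : ∀ {z c} → Section z c → Arrive z (orbit-size a c) (orbit-weight a c) z
  section-cycle (low c<b)  = cast (ℕ.+-comm 1 a) refl (low-cycle c<b)
  section-cycle (high t<b) = cast (ℕ.+-comm 1 a) refl (high-cycle t<b)
  section-cycle centre     = cast refl
    (sym (trans (cong (_∸ 3) (lemma d)) (ℕ.m+n∸n≡m (9 * d + 15) 3))) centre-cycle
    where
    lemma : ∀ d → 9 * (2 + d) ≡ 9 * d + 15 + 3
    lemma = solve-∀
  section-cycle (turn q≤ refl) = cast (lemma₁ a)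
    (sym (trans (cong (_∸ 2) (lemma₂ d)) (ℕ.m+n∸n≡m (3 * (a * a) + 3 * d + 4) 2))) (large-cycle q≤)
    where
    lemma₁ : ∀ a → a * (a + 2) ≡ a * (a * 1) + 2 * a
    lemma₁ = solve-∀
    lemma₂ : ∀ d → 3 * ((2 + d) * ((2 + d) * 1)) + 3 * (2 + d) ≡ 3 * ((2 + d) * (2 + d)) + 3 * d + 4 + 2
    lemma₂ = solve-∀

  -- The bound means a ≥ 3: at a = 2 one has 3a + 2 = a² + 2a. The explicit differences of
  -- consecutive sizes are written with a = 3 + e.
  orbit-size-injective : 1 ≤ d → ∀ {c c′} → orbit-size a c ≡ orbit-size a c′ → c ≡ c′
  orbit-size-injective (s≤s {n = e} _) = go _ _
    where
    small<medium : orbit-size a small < orbit-size a medium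
    small<medium = ℕ.≤-trans (ℕ.m≤m+n _ (2 * a)) (ℕ.≤-reflexive (lemma a))
      where
      lemma : ∀ a → suc (a + 1) + 2 * a ≡ 3 * a + 2
      lemma = solve-∀
    medium<large : orbit-size a medium < orbit-size a large
    medium<large = ℕ.≤-trans (ℕ.m≤m+n _ (3 + 5 * e + e * e)) (ℕ.≤-reflexive (lemma e))
      where
      lemma : ∀ e → suc (3 * (3 + e) + 2) + (3 + 5 * e + e * e) ≡ (3 + e) * ((3 + e) * 1) + 2 * (3 + e)
      lemma = solve-∀
    go : ∀ c c′ → orbit-size a c ≡ orbit-size a c′ → c ≡ c′
    go small  small  _  = refl
    go medium medium _  = refl
    go large  large  _  = refl
    go small  medium eq = contradiction eq (ℕ.<⇒≢ small<medium)
    go medium large  eq = contradiction eq (ℕ.<⇒≢ medium<large)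
    go small  large  eq = contradiction eq (ℕ.<⇒≢ (ℕ.<-trans small<medium medium<large))
    go medium small  eq = contradiction (sym eq) (ℕ.<⇒≢ small<medium)
    go large  medium eq = contradiction (sym eq) (ℕ.<⇒≢ medium<large)
    go large  small  eq = contradiction (sym eq) (ℕ.<⇒≢ (ℕ.<-trans small<medium medium<large))

  Link : Rel State 0ℓ
  Link s t = ∃ λ w → Step s w t

  _⟶*_ : Rel State 0ℓ
  _⟶*_ = Star Link

  arrive⇒* : ∀ {s L W t} → Arrive s L W t → s ⟶* t
  arrive⇒* [ S ]          = (_ , S) ◅ ε
  arrive⇒* (S ∷⟨ _ ⟩ p)   = (_ , S) ◅ arrive⇒* p

  Reaches : State → Set
  Reaches s = ∃₂ λ z c → Section z c × s ⟶* z

  cyc-next : ∀ {q} → q ≤ b → ∃₂ λ q′ w → q′ ≤ b × CycStep b q q′ w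
  cyc-next {q} q≤ = go (ℕ.m≤n⇒m<n∨m≡n q≤)
    where
    go : q < b ⊎ q ≡ b → ∃₂ λ q′ w → q′ ≤ b × CycStep b q q′ w
    go (inj₁ q<)   = suc q , 1 , q< , rise q<
    go (inj₂ refl) = 0 , 0 , z≤n , fall

  reach-turn : ∀ t {i q} → t + i ≡ b → q ≤ b → Reaches (st i 0 (kap q))
  reach-turn zero    refl q≤ = _ , _ , turn q≤ refl , ε
  reach-turn (suc t) {i} eq q≤ with cyc-next q≤
  ... | q′ , w , q′≤ , s with reach-turn t (trans (ℕ.+-suc t i) eq) q′≤
  ...   | z , c , z∈ , p = z , c , z∈ ,
          arrive⇒* (loop (low-rise (ℕ.≤-trans (s≤s (ℕ.m≤n+m i t)) (ℕ.≤-reflexive eq))) (high-loop s))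
          ◅◅ p

  reach-empty : ∀ {i k} → i ≤ b → k ≤ a → Reaches (st i 0 k)
  reach-empty {i} {zero}        i≤ _ = reach-turn (b ∸ i) {q = 0} (ℕ.m∸n+n≡m i≤) z≤n
  reach-empty {i} {suc (suc k)} i≤ (s≤s k<) = reach-turn (b ∸ i) {q = suc k} (ℕ.m∸n+n≡m i≤) k<
  reach-empty {i} {suc zero}    i≤ _ = go (ℕ.m≤n⇒m<n∨m≡n i≤)
    where
    go : i < b ⊎ i ≡ b → Reaches (st i 0 1)
    go (inj₁ i<)   = _ , _ , low i< , ε
    go (inj₂ refl) = _ , _ , centre , ε

  reach-zero : ∀ {i k} → Legal (st i 0 k) → Reaches (st i 0 k)
  reach-zero (legal i≤ _ k≤ i⇒j _) =
    reach-empty (ℕ.≤-pred (ℕ.≤∧≢⇒< i≤ (λ eq → ℕ.n≮n 0 (i⇒j eq)))) k≤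

  -- The second chain rises until it is stuck, so a + 1 - j bounds the number of rises. After a drop
  -- it is empty, a case already settled.
  reach : ∀ fuel {s} → Legal s → suc a ≤ fuel + State.mid s → Reaches s
  reach fuel {st i zero k} L _ = reach-zero L
  reach fuel {st i (suc j) k} L bound = go fuel bound (proj₂ (proj₂ (step-total L)))
    where
    prepend : ∀ {s w t} → Step s w t → Reaches t → Reaches s
    prepend S (z , c , z∈ , p) = z , c , z∈ , (_ , S) ◅ p
    go : ∀ fuel {w t} → suc a ≤ fuel + suc j → Step (st i (suc j) k) w t → Reaches (st i (suc j) k)
    go (suc fuel) bound S@(step _ (rise _ _) _) = prepend S (reach fuel (step-legal S)
      (ℕ.≤-trans bound (ℕ.≤-reflexive (sym (ℕ.+-suc fuel (suc j))))))
    go zero bound (step _ (rise j≤ _) _) = contradiction (ℕ.<-≤-trans bound j≤) (ℕ.n≮n _)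
    go fuel bound S@(step _ (drop _ i′≢a) _) = prepend S (reach-zero (step-legal S))
    -- A push needs the first chain to rise to a, hence i = b: the state is (b, a, 0) on the medium
    -- orbit or, in the next clause, (b, a + 1, k), which is medium for k = 1 and a section point
    -- for k ≥ 2.
    go fuel bound S@(step (rise _ _) (push (inj₁ (refl , refl)) refl) _) =
      _ , _ , centre , arrive⇒* (centre-2 ++⟨ off-centre ⟩ centre-3)
    go fuel bound S@(step (rise _ _) (push (inj₂ refl) refl) _) =
      full-edge k (Legal.mid⇒hi L refl) (Legal.hi≤ L)
      where
      full-edge : ∀ k → 0 < k → k ≤ a → Reaches (st b (suc a) k)
      full-edge (suc zero)    _ _        = _ , _ , centre , arrive⇒* centre-3
      full-edge (suc (suc k)) _ (s≤s k≤) = _ , _ , high k≤ , ε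

  climb-* : ∀ t i q → t + i ≤ b → t + q ≤ b → st i 0 (kap q) ⟶* st (t + i) 0 (kap (t + q))
  climb-* zero    i q _  _  = ε
  climb-* (suc t) i q i≤ q≤ =
    arrive⇒* (loop (low-rise (ℕ.≤-trans (s≤s (ℕ.m≤n+m i t)) i≤))
                    (high-loop (rise (ℕ.≤-trans (s≤s (ℕ.m≤n+m q t)) q≤))))
    ◅◅ subst₂ (λ i′ q′ → st (suc i) 0 (kap (suc q)) ⟶* st i′ 0 (kap q′)) (ℕ.+-suc t i) (ℕ.+-suc t q)
         (climb-* t (suc i) (suc q) (ℕ.≤-trans (ℕ.≤-reflexive (ℕ.+-suc t i)) i≤)
                                    (ℕ.≤-trans (ℕ.≤-reflexive (ℕ.+-suc t q)) q≤))

  Joined : Rel State 0ℓ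
  Joined s t = ∃ λ u → Legal u × u ⟶* s × u ⟶* t

  -- A large orbit passes through the complement of its section point
  -- halfway through the loop on which q = 0.
  comp-large : ∀ {q} → q ≤ b → Joined (st b 0 (kap q)) (comp (st b 0 (kap q)))
  comp-large {zero} q≤ = st b 0 0 , section-legal (turn q≤ refl) , ε ,
    subst (λ i → st b 0 0 ⟶* st a (suc a) i) (sym (ℕ.m+n∸n≡m 1 b))
      (arrive⇒* (fill-up low-fall (high-loop (rise (s≤s z≤n)))))
  comp-large {suc t} q≤@(s≤s t≤d) = st (d ∸ t) 0 0 ,
    legal (ℕ.<⇒≤ dt<a) z≤n z≤n (λ eq → contradiction eq (ℕ.<⇒≢ dt<a)) (λ ()) ,
    subst₂ (λ i q → st (d ∸ t) 0 0 ⟶* st i 0 (kap q)) total (ℕ.+-identityʳ (suc t))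
      (climb-* (suc t) (d ∸ t) 0 (ℕ.≤-reflexive total)
        (ℕ.≤-trans (ℕ.≤-reflexive (ℕ.+-identityʳ (suc t))) q≤)) ,
    subst (λ i → st (d ∸ t) 0 0 ⟶* st (d ∸ t) (suc a) i) (sym (ℕ.m+n∸n≡m 1 b))
      (arrive⇒* (fill-up (low-rise dt<b) (high-loop (rise (s≤s z≤n)))))
    where
    dt<b : d ∸ t < b
    dt<b = s≤s (ℕ.m∸n≤m d t)
    dt<a : d ∸ t < a
    dt<a = ℕ.m<n⇒m<1+n dt<b
    total : suc t + (d ∸ t) ≡ b
    total = cong suc (ℕ.m+[n∸m]≡n t≤d)

  -- The complement of the centre is (b, a + 1, 1), the state in which the second climb of the
  -- medium orbit ends.
  comp-centre : Joined (st b 0 1) (comp (st b 0 1))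
  comp-centre = st b 0 1 , section-legal centre , ε ,
    subst (λ i → st b 0 1 ⟶* st b (suc a) i) (sym (ℕ.m+n∸n≡m 1 b))
      (arrive⇒* (centre-1 ++⟨ offₐ ⟩ centre-2))

  comp-low : ∀ {c} → c < b → ∃ λ t → t < b × comp (st c 0 1) ≡ st b (suc a) (2 + t)
  comp-low {c} (s≤s c≤d) = d ∸ c , s≤s (ℕ.m∸n≤m d c) , cong (st b (suc a)) (ℕ.+-∸-assoc 2 c≤d)

  comp-high : ∀ {t} → t < b → ∃ λ c → c < b × comp (st b (suc a) (2 + t)) ≡ st c 0 1
  comp-high {t} (s≤s t≤d) = d ∸ t , s≤s (ℕ.m∸n≤m d t) , cong₂ (st (d ∸ t)) (ℕ.n∸n≡0 d) (ℕ.m+n∸n≡m 1 b)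

-- From triples to any system that they model faithfully.

module Transfer (d : ℕ) {X : Set} (f : X → X) (size : X → ℕ) (_has_ : X → State → Set) where

  open Orbits d
  open Dynamics b

  record IsModel : Set where
    field
      f-has          : ∀ {x s w t} → x has s → Step s w t → f x has t
      size-f         : ∀ {x s w t} → x has s → Step s w t → size (f x) ≡ w
      has-state      : ∀ x → ∃ λ s → Legal s × x has s
      has-injective  : ∀ {x y s} → x has s → y has s → x ≡ y
      has-functional : ∀ {x s t} → x has s → x has t → Legal s → Legal t → s ≡ t
      realise        : ∀ {s} → Legal s → ∃ (_has s)
      f-injective    : ∀ {x y} → f x ≡ f y → x ≡ y

  module Model (isModel : IsModel) where

    open IsModel isModel
    open Cycle f f-injective

    -- Weights belong to the targets of steps, so the sum omits the start and includes the endpoint.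
    -- For a closed walk the two coincide.
    record Walk (A : X) (t W : ℕ) (s : State) : Set where
      field
        arrives  : fold A f (suc t) has s
        interior : ∀ {B} → B List.∈ iterate f (f A) t → ∃ λ s → Legal s × B has s × Off s
        weight   : sum (List.map size (iterate f (f A) t)) + size (fold A f (suc t)) ≡ W

    walk : ∀ {A s L W u} → Arrive s L W u → A has s → ∃ λ t → L ≡ suc t × Walk A t W u
    walk [ S ] A-s = 0 , refl , record { arrives = f-has A-s S ; interior = λ () ; weight = size-f A-s S }
    walk {A} {u = u} (_∷⟨_⟩_ {w = w} {t = s′} S off p) A-s = go (walk p fA-s′)
      where
      fA-s′ : f A has s′
      fA-s′ = f-has A-s S
      go : ∀ {L W} → (∃ λ t → L ≡ suc t × Walk (f A) t W u) → ∃ λ t → suc L ≡ suc t × Walk A t (w + W) u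
      go (t , refl , q) = suc t , refl , record
        { arrives  = subst (_has u) (fold-suc A (suc t)) arrives
        ; interior = λ { (here refl) → s′ , step-legal S , fA-s′ , off ; (there B∈) → interior B∈ }
        ; weight   = trans (ℕ.+-assoc (size (f A)) _ _) (cong₂ _+_ (size-f A-s S)
                       (trans (cong (λ B → sum (List.map size (iterate f (f (f A)) t)) + size B)
                                (sym (fold-suc A (suc t)))) weight))
        }
        where open Walk q

    module _ {R z c} (R-z : R has z) (z∈ : Section z c) where

      private
        returning : ∃ λ t → orbit-size a c ≡ suc t × Walk R t (orbit-weight a c) z
        returning = walk (section-cycle z∈) R-z
        t = proj₁ returning
        open Walk (proj₂ (proj₂ returning))

        return : fold R f (suc t) ≡ R
        return = has-injective arrives R-z

        first-return : ¬ R List.∈ iterate f (f R) t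
        first-return R∈ = go (interior R∈)
          where
          go : ¬ ∃ λ s → Legal s × R has s × Off s
          go (s , L , R-s , off) = off
            (subst (λ s → Section s c) (has-functional R-z R-s (section-legal z∈) L) z∈)

      section-period : Period f size R (orbit-size a c) (orbit-weight a c)
      section-period = record
        { t = t ; length≡ = proj₁ (proj₂ returning) ; return = return ; first = first-return
        ; size≡ = trans (ℕ.+-comm (size R) _)
            (trans (cong (λ B → sum (List.map size (iterate f (f R) t)) + size B) (sym return)) weight) }

      -- A point equivalent to `R` lies on its cycle, and between departure and return that cycle
      -- avoids the section.
      section-unique : ∀ {R′ z′ c′} → R′ has z′ → Section z′ c′ → R ∼ R′ → z ≡ z′
      section-unique {R′} {z′} R′-z′ z′∈ R∼R′ = go (Equivalence.to (∼⇔∈cycle {R} {t} return {R′}) R∼R′)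
        where
        go : R′ List.∈ iterate f R (suc t) → z ≡ z′
        go (here R′≡R) = has-functional R-z (subst (_has z′) R′≡R R′-z′)
            (section-legal z∈) (section-legal z′∈)
        go (there R′∈) = within (interior R′∈)
          where
          within : (∃ λ s → Legal s × R′ has s × Off s) → z ≡ z′
          within (s , L , R′-s , off) =
            contradiction
                (subst (λ s → Section s _) (has-functional R′-z′ R′-s (section-legal z′∈) L) z′∈) off

    *⇒∼ : ∀ {A B s t} → s ⟶* t → A has s → B has t → A ∼ B
    *⇒∼ ε A-s B-t = subst (_ ∼_) (has-injective A-s B-t) ε
    *⇒∼ ((_ , S) ◅ p) A-s B-t = fwd refl ◅ *⇒∼ p (f-has A-s S) B-t

    joined⇒∼ : ∀ {A B s t} → Joined s t → A has s → B has t → A ∼ B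
    joined⇒∼ (u , L , p , q) A-s B-t = go (realise L)
      where
      go : ∃ (_has u) → _ ∼ _
      go (C , C-u) = Eq.symmetric _ (*⇒∼ p C-u A-s) ◅◅ *⇒∼ q C-u B-t

    record Representative (A : X) : Set where
      field
        {point} : State
        {type}  : Class
        section : Section point type
        R       : X
        R-point : R has point
        A∼R     : A ∼ R

    abstract
      representative : ∀ A → Representative A
      representative A = go (has-state A)
        where
        go : (∃ λ s → Legal s × A has s) → Representative A
        go (s , L , A-s) = go′ (reach (suc a) L (ℕ.m≤m+n (suc a) (State.mid s)))
          where
          go′ : Reaches s → Representative A
          go′ (z , c , z∈ , p) = record
            { section = z∈ ; R = proj₁ R ; R-point = proj₂ R ; A∼R = *⇒∼ p A-s (proj₂ R) }
            where
            R : ∃ (_has z)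
            R = realise (section-legal z∈)

    type-of : X → Class
    type-of A = Representative.type (representative A)

    representative-unique : ∀ {A B z c} → A ∼ B → B has z → Section z c →
                            Representative.point (representative A) ≡ z
    representative-unique {A} A∼B B-z z∈ =
      section-unique R-point section B-z z∈ (Eq.symmetric _ A∼R ◅◅ A∼B)
      where open Representative (representative A)

    type-unique : ∀ {A B z c} → A ∼ B → B has z → Section z c → type-of A ≡ c
    type-unique {A} {c = c} A∼B B-z z∈ =
      section-class (Representative.section (representative A))
        (subst (λ z → Section z c) (sym (representative-unique A∼B B-z z∈)) z∈)

    type-respects-∼ : ∀ {A B} → A ∼ B → type-of A ≡ type-of B
    type-respects-∼ {A} {B} A∼B = type-unique (A∼B ◅◅ A∼R) R-point section
      where open Representative (representative B)

    -- Agrees definitionally with `part` of the partition given by `type-of`.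
    type-class : Class → Setoid 0ℓ 0ℓ
    type-class c = On.setoid {B = Σ X (λ x → type-of x ≡ c)} (Eq.setoid (λ x y → f x ≡ y)) proj₁

    -- Counting orbits of a class amounts to counting its section points: distinct ones lie in
    -- distinct orbits, and every orbit of the class contains one.
    part-cardinality : ∀ {c k} {K : Set} → Fin k ↔ K → (e : K → State) → (∀ i → Section (e i) c) →
                       (∀ {i j} → e i ≡ e j → i ≡ j) → (∀ {z} → Section z c → ∃ λ i → e i ≡ z) →
                       type-class c hasCardinality k
    part-cardinality {c} {k} {K} index e e∈ e-injective e-surjective = record
      { to = to ; cong = λ { refl → ε } ; bijective = injective , surjective }
      where
      module index = Inverse index
      R : K → X
      R i = proj₁ (realise (section-legal (e∈ i)))
      R-e : ∀ i → R i has e i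
      R-e i = proj₂ (realise (section-legal (e∈ i)))
      to : Fin k → Σ X (λ A → type-of A ≡ c)
      to i = R (index.to i) , type-unique ε (R-e _) (e∈ _)
      injective : ∀ {i j} → proj₁ (to i) ∼ proj₁ (to j) → i ≡ j
      injective {i} {j} p = trans (sym (index.strictlyInverseʳ i))
        (trans (cong index.from (e-injective (section-unique (R-e _) (e∈ _) (R-e _) (e∈ _) p)))
          (index.strictlyInverseʳ j))
      surjective : ∀ (y : Σ X (λ A → type-of A ≡ c)) → ∃ λ i → ∀ {j} → j ≡ i → proj₁ (to j) ∼ proj₁ y
      surjective (A , A∈c) = go (e-surjective (subst (Section _) A∈c section))
        where
        open Representative (representative A) renaming (R to R′)
        go : (∃ λ i → e i ≡ point) → ∃ λ i → ∀ {j} → j ≡ i → proj₁ (to j) ∼ A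
        go (i , ei≡z) = index.from i , λ { refl →
          subst (_∼ A) (has-injective R-point (subst (R (index.to (index.from i)) has_)
            (trans (cong e (index.strictlyInverseˡ i)) ei≡z) (R-e _))) (Eq.symmetric _ A∼R) }

    small-cardinality : type-class small hasCardinality (2 * a ∸ 2)
    small-cardinality = subst (type-class small hasCardinality_) (lemma d)
      (part-cardinality (Fin.+↔⊎ {b} {b}) e e∈ e-injective e-surjective)
      where
      lemma : ∀ d → suc d + suc d ≡ d + (2 + (d + 0))
      lemma d = trans (sym (ℕ.+-suc d (suc d))) (cong (λ t → d + (2 + t)) (sym (ℕ.+-identityʳ d)))
      e : Fin b ⊎ Fin b → State
      e (inj₁ i) = st (toℕ i) 0 1
      e (inj₂ i) = st b (suc a) (2 + toℕ i)
      e∈ : ∀ i → Section (e i) small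
      e∈ (inj₁ i) = low (Fin.toℕ<n i)
      e∈ (inj₂ i) = high (Fin.toℕ<n i)
      e-injective : ∀ {i j} → e i ≡ e j → i ≡ j
      e-injective {inj₁ i} {inj₁ j} eq = cong inj₁ (Fin.toℕ-injective (cong State.lo eq))
      e-injective {inj₂ i} {inj₂ j} eq = cong inj₂
        (Fin.toℕ-injective (ℕ.suc-injective (ℕ.suc-injective (cong State.hi eq))))
      e-surjective : ∀ {z} → Section z small → ∃ λ i → e i ≡ z
      e-surjective (low c<)  = inj₁ (fromℕ< c<) , cong (λ c → st c 0 1) (Fin.toℕ-fromℕ< c<)
      e-surjective (high t<) = inj₂ (fromℕ< t<) , cong (λ t → st b (suc a) (2 + t)) (Fin.toℕ-fromℕ< t<)

    medium-cardinality : type-class medium hasCardinality 1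
    medium-cardinality = part-cardinality (Identity.↔-id (Fin 1)) (λ _ → st b 0 1) (λ _ → centre)
      (λ { {zero} {zero} _ → refl }) (λ { centre → zero , refl })

    large-cardinality : type-class large hasCardinality a
    large-cardinality = part-cardinality (Identity.↔-id (Fin a)) (λ i → st b 0 (kap (toℕ i)))
      (λ i → turn (ℕ.≤-pred (Fin.toℕ<n i)) refl)
      (λ eq → Fin.toℕ-injective (kap-injective (cong State.hi eq)))
      (λ { (turn q≤ refl) → fromℕ< (s≤s q≤) , cong (λ q → st b 0 (kap q)) (Fin.toℕ-fromℕ< (s≤s q≤)) })
      where
      kap-injective : ∀ {p q} → kap p ≡ kap q → p ≡ q
      kap-injective {zero}  {zero}  _  = refl
      kap-injective {suc p} {suc q} eq = ℕ.suc-injective eq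

-- Antichains of the fence: the partition, homometry and dihedral orbits.

module Classification {a₀ d : ℕ} (a₀≡ : a₀ ≡ suc (suc d)) where

  open Orbits d
  open Fence a₀
  open OrbitStatistics isDecPartialOrder
  open Dynamics b
  open Simulation a₀≡
  open Transition a₀≡

  isModel : Transfer.IsModel d ρ size _has_
  isModel = record
    { f-has = ρ-has ; size-f = size-ρ ; has-state = has-state ; has-injective = has-injective
    ; has-functional = has-functional ; realise = realise ; f-injective = ρ-injective }

  open Transfer.Model d ρ size _has_ isModel public

  partition : Partition a₀
  partition = record
    { class    = type-of
    ; respects = type-respects-∼
    }

  representative-period : ∀ A → let open Representative (representative A) in
                          Period ρ size R (orbit-size a type) (orbit-weight a type)
  representative-period A = section-period R-point section
    where open Representative (representative A)

  #-type : ∀ A → # A ≡ orbit-size a (type-of A)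
  #-type A = #-period ρ-injective (representative-period A)
    (Eq.symmetric _ (Representative.A∼R (representative A)))

  χ-type : ∀ A → χ A ≡ orbit-weight a (type-of A)
  χ-type A = χ-period ρ-injective (representative-period A)
    (Eq.symmetric _ (Representative.A∼R (representative A)))

  homometric : 1 ≤ d → Homometric
  homometric 1≤d A B eq = trans (χ-type A)
    (trans (cong (orbit-weight a) (orbit-size-injective 1≤d {type-of A} {type-of B}
      (trans (sym (#-type A)) (trans eq (#-type B)))))
      (sym (χ-type B)))

  ∼⇒∼̂ : ∀ {A B} → A ∼ B → ⟨ A ⟩ ∼̂ ⟨ B ⟩
  ∼⇒∼̂ = Eq.gmap ⟨_⟩ (cong ⟨_⟩)

  -- Forward edges become backward ones and conversely, and `∼̂` admits both.
  complement-∼̂ : ∀ {I J} → I ∼̂ J → complement I ∼̂ complement J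
  complement-∼̂ ε               = ε
  complement-∼̂ (_◅_ {I} (fwd refl) p) = bwd (ρ̂-complement-ρ̂ I) ◅ complement-∼̂ p
  complement-∼̂ (_◅_ {j = J} (bwd refl) p) = fwd (ρ̂-complement-ρ̂ J) ◅ complement-∼̂ p

  -- The orbits of `I` and of its complement together are stable under both generators, so a
  -- dihedral path never leaves their union.
  dihedral⁻ : ∀ {I J} → I ∼ᴰ J → I ∼̂ J ⊎ complement I ∼̂ J
  dihedral⁻ {I} = extend (inj₁ ε)
    where
    reflect : ∀ {J} → I ∼̂ J ⊎ complement I ∼̂ J → I ∼̂ complement J ⊎ complement I ∼̂ complement J
    reflect (inj₁ p) = inj₂ (complement-∼̂ p)
    reflect {J} (inj₂ p) = inj₁ (subst (_∼̂ complement J) (complement-involutive I) (complement-∼̂ p))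
    along : ∀ {J K} → J ∼̂ K → I ∼̂ J ⊎ complement I ∼̂ J → I ∼̂ K ⊎ complement I ∼̂ K
    along q (inj₁ p) = inj₁ (p ◅◅ q)
    along q (inj₂ p) = inj₂ (p ◅◅ q)
    extend : ∀ {J K} → I ∼̂ J ⊎ complement I ∼̂ J → J ∼ᴰ K → I ∼̂ K ⊎ complement I ∼̂ K
    extend p ε                        = p
    extend p (fwd (inj₁ eq) ◅ q)      = extend (along (fwd eq ◅ ε) p) q
    extend p (bwd (inj₁ eq) ◅ q)      = extend (along (bwd eq ◅ ε) p) q
    extend p (fwd (inj₂ refl) ◅ q)    = extend (reflect p) q
    extend {J} p (_◅_ {j = K} (bwd (inj₂ refl)) q) =
      -- A complement edge traversed backwards is one traversed forwards, because the complement is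
      -- an involution.
      extend (subst (λ K → I ∼̂ K ⊎ complement I ∼̂ K) (complement-involutive K) (reflect p)) q

  dihedral⁺ : ∀ {I J} → I ∼̂ J ⊎ complement I ∼̂ J → I ∼ᴰ J
  dihedral⁺ (inj₁ p) = Eq.map inj₁ p
  dihedral⁺ (inj₂ p) = fwd (inj₂ refl) ◅ Eq.map inj₁ p

  dihedral-single : ∀ {I A} → I ∼̂ ⟨ A ⟩ → complement I ∼̂ ⟨ A ⟩ → DihedralOrbitIs I A
  dihedral-single {I} {A} p q J = mk⇔ (to ∘ dihedral⁻) (λ o → dihedral⁺ (inj₁ (p ◅◅ o)))
    where
    to : I ∼̂ J ⊎ complement I ∼̂ J → ⟨ A ⟩ ∼̂ J
    to (inj₁ o) = Eq.symmetric _ p ◅◅ o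
    to (inj₂ o) = Eq.symmetric _ q ◅◅ o

  dihedral-union : ∀ {I A B} → I ∼̂ ⟨ A ⟩ → complement I ∼̂ ⟨ B ⟩ → DihedralOrbitIsUnion I A B
  dihedral-union {I} {A} {B} p q J = mk⇔ (to ∘ dihedral⁻) (dihedral⁺ ∘ from)
    where
    to : I ∼̂ J ⊎ complement I ∼̂ J → ⟨ A ⟩ ∼̂ J ⊎ ⟨ B ⟩ ∼̂ J
    to (inj₁ o) = inj₁ (Eq.symmetric _ p ◅◅ o)
    to (inj₂ o) = inj₂ (Eq.symmetric _ q ◅◅ o)
    from : ⟨ A ⟩ ∼̂ J ⊎ ⟨ B ⟩ ∼̂ J → I ∼̂ J ⊎ complement I ∼̂ J
    from (inj₁ o) = inj₁ (p ◅◅ o)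
    from (inj₂ o) = inj₂ (q ◅◅ o)

  dihedral-orbits : ∀ I →
      (∃ λ A → (type-of A ≡ medium ⊎ type-of A ≡ large) × DihedralOrbitIs I A)
    ⊎ (∃₂ λ A B → type-of A ≡ small × type-of B ≡ small × ¬ (A ∼ B) × DihedralOrbitIsUnion I A B)
  dihedral-orbits I = go (generator I)
    where
    Goal : Set
    Goal = (∃ λ A → (type-of A ≡ medium ⊎ type-of A ≡ large) × DihedralOrbitIs I A)
      ⊎ (∃₂ λ A B → type-of A ≡ small × type-of B ≡ small × ¬ (A ∼ B) × DihedralOrbitIsUnion I A B)
    go : (∃ λ A → ⟨ A ⟩ ≡ I) → Goal
    go (A , ⟨A⟩≡I) = cases section R-point
      where
      open Representative (representative A)
      I∼R : I ∼̂ ⟨ R ⟩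
      I∼R = subst (_∼̂ ⟨ R ⟩) ⟨A⟩≡I (∼⇒∼̂ A∼R)
      I̅∼ : ∀ {z} B → Legal z → R has z → B has comp z → complement I ∼̂ ⟨ B ⟩
      I̅∼ B L R-z B-z̅ = subst (complement I ∼̂_) (complement-⟨⟩ L R-z B-z̅)
        (complement-∼̂ I∼R)
      single : ∀ {z c} → c ≡ medium ⊎ c ≡ large → Section z c → R has z → Joined z (comp z) → Goal
      single {z} {c} c≡ z∈ R-z J = inj₁ (R ,
        subst (λ c → c ≡ medium ⊎ c ≡ large) (sym (type-unique ε R-z z∈)) c≡ ,
        dihedral-single {I} {R} I∼R
          (I̅∼ (proj₁ B) L R-z (proj₂ B) ◅◅ Eq.symmetric _ (∼⇒∼̂ (joined⇒∼ J R-z (proj₂ B)))))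
        where
        L = section-legal z∈
        B = realise (comp-legal {z} L)
      pair : ∀ {z} → Section z small → R has z → Section (comp z) small → z ≢ comp z → Goal
      pair {z} z∈ R-z z̅∈ z≢z̅ = inj₂ (R , proj₁ B , type-unique ε R-z z∈ , type-unique ε (proj₂ B) z̅∈ ,
        (λ R∼B → z≢z̅ (section-unique R-z z∈ (proj₂ B) z̅∈ R∼B)) ,
        dihedral-union {I} {R} {proj₁ B} I∼R (I̅∼ (proj₁ B) L R-z (proj₂ B)))
        where
        L = section-legal z∈
        B = realise (comp-legal {z} L)
      cases : ∀ {z c} → Section z c → R has z → Goal
      cases {z} z∈@(low c<) R-z = opposite (comp-low c<)
        where
        opposite : (∃ λ t → t < b × comp z ≡ st b (suc a) (2 + t)) → Goal
        opposite (t , t< , eq) = pair {z} z∈ R-z (subst (λ z → Section z small) (sym eq) (high t<))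
          (λ z≡z̅ → contradiction (cong State.mid (trans z≡z̅ eq)) λ ())
      cases {z} z∈@(high t<) R-z = opposite (comp-high t<)
        where
        opposite : (∃ λ c → c < b × comp z ≡ st c 0 1) → Goal
        opposite (c , c< , eq) = pair {z} z∈ R-z (subst (λ z → Section z small) (sym eq) (low c<))
          (λ z≡z̅ → contradiction (cong State.mid (trans z≡z̅ eq)) λ ())
      cases centre R-z = single (inj₁ refl) centre R-z comp-centre
      cases (turn q≤ refl) R-z = single (inj₂ refl) (turn q≤ refl) R-z (comp-large q≤)

theorem4p6 : (a : ℕ) → 2 ≤ a →
    let open Fence a in
    Σ (Partition a) λ 𝒫 →
    let open Partition 𝒫 in
    ( part small hasCardinality (2 * a ∸ 2)
    × part medium hasCardinality 1
    × part large hasCardinality a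
    × (∀ A → class A ≡ small → # A ≡ a + 1)
    × (∀ A → class A ≡ medium → # A ≡ 3 * a + 2)
    × (∀ A → class A ≡ large → # A ≡ a ^ 2 + 2 * a) )
    × ( (3 ≤ a → Homometric)
    × (∀ A → class A ≡ small → χ A ≡ 3 * a)
    × (∀ A → class A ≡ medium → χ A ≡ 9 * a ∸ 3)
    × (∀ A → class A ≡ large → χ A ≡ 3 * a ^ 2 + 3 * a ∸ 2) )
    × ( ∀ (I : Ideal) →
    (∃ λ A → (class A ≡ medium ⊎ class A ≡ large) × DihedralOrbitIs I A)
    ⊎ (∃₂ λ A B → class A ≡ small × class B ≡ small × ¬ (A ∼ B) × DihedralOrbitIsUnion I A B) )
theorem4p6 a 2≤a = partition ,
  (subst (λ a → part small hasCardinality (2 * a ∸ 2)) (sym a≡) small-cardinality ,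
   medium-cardinality ,
   subst (part large hasCardinality_) (sym a≡) large-cardinality ,
   size-of small , size-of medium , size-of large) ,
  ((λ 3≤a → homometric (ℕ.∸-monoˡ-≤ 2 3≤a)) , weight-of small , weight-of medium , weight-of large) ,
  dihedral-orbits
  where
  a≡ : a ≡ suc (suc (a ∸ 2))
  a≡ = sym (ℕ.m+[n∸m]≡n 2≤a)
  open Classification a≡
  open Fence a
  open Partition partition using (class; part)
  size-of : ∀ c A → class A ≡ c → # A ≡ orbit-size a c
  size-of c A refl = trans (#-type A) (cong (λ a → orbit-size a c) (sym a≡))
  weight-of : ∀ c A → class A ≡ c → χ A ≡ orbit-weight a c
  weight-of c A refl = trans (χ-type A) (cong (λ a → orbit-weight a c) (sym a≡))
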